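{- Let $q=p^{\alpha}$ be a prime power with $q\equiv 1\pmod 4$ and $p\neq 5$, and let $D=(P,B)$ and $G=\operatorname{PSL}(2,q)$ be as in the context. Then $D$ is a $\mathrm{GPBIBD}(m)$ with parameters $$v=\frac{q^2-1}{4},\quad b=\frac{q(q^2-1)}{24},\quad k=6,\quad r=q,\quad \lambda_1=4,\quad \lambda_2=1,\quad \lambda_3=\dots=\lambda_m=0,$$ whose underlying association scheme is the Schurian scheme $\mathcal{S}(G,P)$ of the action of $G$ on $P$, and the number of associate classes is $m=\frac{q-3}{2}$.
   Context: Let $\omega$ be a generator of $\mathbb{F}_q^{\times}$ and $i=\omega^{(q-1)/4}$. Let $P=(\mathbb{F}_q^2\setminus\{0\})/\langle i\rangle$ (nonzero column vectors with $\pi,-\pi,i\pi,-i\pi$ identified). $G=\operatorname{PSL}(2,q)=\operatorname{SL}(2,q)/\{\pm I\}$ acts on $P$ by multiplying representatives. Let $T\subseteq P$ be the set of classes of $\binom{1}{0},\binom{0}{1},\binom{1}{1},\binom{1+i}{1},\binom{i}{1},\binom{1}{1-i}$, $B=\{gT:g\in G\}$, and $D=(P,B)$ the incidence structure with points $P$ and blocks $B$. An association scheme with $m$ classes on a finite set $X$ is a partition of $X\times X$ into relations $R_0,\dots,R_m$ with $R_0=\{(x,x)\}$, each $R_j^{ -1}$ again one of the relations, and such that for $(x,z)\in R_k$ the number of $y$ with $(x,y)\in R_i,(y,z)\in R_j$ depends only on $i,j,k$. The Schurian scheme $\mathcal{S}(G,P)$ has as relations the orbits of $G$ on $P\times P$.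 A $\mathrm{GPBIBD}(m)$ with parameters $v,b,k,r,\lambda_1,\dots,\lambda_m$ is a block design with $v$ points and $b$ blocks, each block of size $k$, each point on $r$ blocks, together with an association scheme (not necessarily symmetric) with classes $R_0,\dots,R_m$ on the point set such that for each $1\le j\le m$ any pair $(x,y)\in R_j$ lies together in exactly $\lambda_j$ blocks (for a suitable numbering of the non-identity classes). -}

module Defs where

open import Level using (0ℓ)
open import Data.Nat as ℕ using (ℕ; zero; suc)
open import Data.Nat.Primality using (Prime)
open import Data.Fin using (Fin; zero; suc)
open import Data.Vec using (Vec; lookup)
open import Data.List using (List; length)
open import Data.List.Membership.Propositional using (_∈_)
open import Data.List.Relation.Unary.Unique.Propositional using (Unique)
open import Data.Product using (Σ; ∃; _×_; _,_)
open import Data.Unit using (⊤)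
open import Relation.Nullary using (¬_; Dec)
open import Relation.Binary.PropositionalEquality using (_≡_)
open import Algebra.Structures using (IsCommutativeRing)

record FiniteField : Set₁ where
  infixl 6 _+_
  infixl 7 _*_
  field
    Carrier : Set
    _+_ _*_ : Carrier → Carrier → Carrier
    -_      : Carrier → Carrier
    0# 1#   : Carrier
    isCommutativeRing : IsCommutativeRing _≡_ _+_ _*_ -_ 0# 1#
    0≢1     : ¬ (0# ≡ 1#)
    inverse : ∀ x → ¬ (x ≡ 0#) → Σ Carrier λ y → x * y ≡ 1#
    _≟_     : (x y : Carrier) → Dec (x ≡ y)
    elements : List Carrier
    elements-unique   : Unique elements
    elements-complete : ∀ x → x ∈ elements

  order : ℕ
  order = length elements

  _-_ : Carrier → Carrier → Carrier
  x - y = x + (- y)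

  _^_ : Carrier → ℕ → Carrier
  x ^ zero  = 1#
  x ^ suc n = x * (x ^ n)

-- Cardinality of a subset of a quotient:  Count R Q n  says that the
-- set { [x] : Q x } of classes of the equivalence R (Q being R-invariant)
-- has exactly n elements: there are n pairwise R-inequivalent
-- representatives satisfying Q, and every x satisfying Q is R-equivalent
-- to one of them.

Count : {X : Set} → (X → X → Set) → (X → Set) → ℕ → Set
Count {X} R Q n =
  Σ (Vec X n) λ reps →
    (∀ j → Q (lookup reps j)) ×
    (∀ j j' → R (lookup reps j) (lookup reps j') → j ≡ j') ×
    (∀ x → Q x → ∃ λ j → R x (lookup reps j))

module Geometry (F : FiniteField) where
  open FiniteField F

  V : Set
  V = Carrier × Carrier

  NonZero : V → Set
  NonZero (x , y) = ¬ ((x ≡ 0#) × (y ≡ 0#))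

  scale : Carrier → V → V
  scale c (x , y) = (c * x , c * y)

  IsGenerator : Carrier → Set
  IsGenerator ω = ∀ x → ¬ (x ≡ 0#) → ∃ λ n → x ≡ ω ^ n

  record Mat : Set where
    constructor mat
    field a b c d : Carrier

  det : Mat → Carrier
  det (mat a b c d) = (a * d) - (b * c)

  SL : Set
  SL = Σ Mat λ g → det g ≡ 1#

  act : SL → V → V
  act (mat a b c d , _) (x , y) = (a * x + b * y , c * x + d * y)

  module WithGenerator (ω : Carrier) where

    i : Carrier
    i = ω ^ ((order ℕ.∸ 1) ℕ./ 4)

    -- u ~ v  iff  v ∈ ⟨i⟩ u ; points of P are the ~-classes of nonzero vectors
    _~_ : V → V → Set
    u ~ v = ∃ λ n → v ≡ scale (i ^ n) u

    Tvec : Fin 6 → V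
    Tvec zero = (1# , 0#)
    Tvec (suc zero) = (0# , 1#)
    Tvec (suc (suc zero)) = (1# , 1#)
    Tvec (suc (suc (suc zero))) = (1# + i , 1#)
    Tvec (suc (suc (suc (suc zero)))) = (i , 1#)
    Tvec (suc (suc (suc (suc (suc zero))))) = (1# , 1# - i)

    -- the point [u] lies on the block gT
    _∈B_ : V → SL → Set
    u ∈B g = ∃ λ j → u ~ act g (Tvec j)

    _≈B_ : SL → SL → Set
    g ≈B h = (∀ j → ∃ λ j' → act g (Tvec j) ~ act h (Tvec j')) ×
             (∀ j → ∃ λ j' → act h (Tvec j) ~ act g (Tvec j'))

    -- (u,v) and (u',v') lie in the same orbit of G = PSL(2,q) on P × P
    SameOrbit : V → V → V → V → Set
    SameOrbit u v u' v' = ∃ λ (g : SL) → (act g u ~ u') × (act g v ~ v')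

    -- cls : P × P → {0,…,m} is the partition of P × P into the
    -- G-orbits (the Schurian scheme S(G,P)), with class 0 the diagonal
    IsSchurianPartition : {m : ℕ} → (V → V → Fin (suc m)) → Set
    IsSchurianPartition {m} cls =
      (∀ u v u' v' → NonZero u → NonZero v → NonZero u' → NonZero v' →
         (cls u v ≡ cls u' v' → SameOrbit u v u' v') ×
         (SameOrbit u v u' v' → cls u v ≡ cls u' v')) ×
      (∀ (c : Fin (suc m)) → ∃ λ u → ∃ λ v →
         NonZero u × NonZero v × cls u v ≡ c)

    IsAssociationScheme : {m : ℕ} → (V → V → Fin (suc m)) → Set
    IsAssociationScheme {m} cls =
      (∀ u v → NonZero u → NonZero v → (cls u v ≡ zero → u ~ v) × (u ~ v → cls u v ≡ zero)) ×
      (∀ c → ∃ λ c' → ∀ u v → NonZero u → NonZero v →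
         (cls u v ≡ c → cls v u ≡ c') × (cls v u ≡ c' → cls u v ≡ c)) ×
      (∀ a b c → ∃ λ p → ∀ u w → NonZero u → NonZero w → cls u w ≡ c →
         Count _~_ (λ v → NonZero v × cls u v ≡ a × cls v w ≡ b) p)

-- λ_1 = 4, λ_2 = 1, λ_3 = … = λ_m = 0   (λ_0 unused)
lambdas : {n : ℕ} → Fin n → ℕ
lambdas (suc zero) = 4
lambdas (suc (suc zero)) = 1
lambdas _ = 0

{-# OPTIONS --safe #-}
module Submission where

-- T is an octahedron: det is a power of i on adjacent vertices and 1 - i times a power of i on
-- antipodal ones, and since (1 - i)⁴ = - 4 ≠ 1 for p ≠ 5 these two cases differ.  The rotations
-- σ and ρ of T act transitively on its vertices, so a block through e₁ = (1 , 0) can be written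
-- gT with g e₁ ~ e₁, and after correcting g by a power of ρ, which multiplies e₁ by i, with
-- g = shear t.  The t are in bijection with the field, which gives r = q, and the blocks through
-- e₁ and a second point are read off from the equation for t.  Everything else is counting: v from
-- the q² - 1 nonzero vectors, b from the flags (v r = 6 b), and the number of classes from the
-- orbits of pairs, which are classified by the ratio or by the determinant modulo powers of i.

open import Defs
open import Level using (0ℓ)
open import Algebra.Bundles using (CommutativeRing; RawRing)
import Algebra.Solver.Ring as RingSolver
open import Algebra.Solver.Ring.AlmostCommutativeRing using (fromCommutativeRing; _-Raw-AlmostCommutative⟶_)
open import Data.Empty using (⊥-elim)
open import Data.Fin as Fin using (Fin; zero; suc; toℕ; inject₁)
open import Data.Fin.Patterns using (0F; 1F; 2F; 3F; 4F; 5F)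
import Data.Fin.Properties as Finₚ
open import Data.Fin.Properties using (+↔⊎; *↔×; injective⇒≤; any?; all?)
import Data.Integer.Properties as ℤₚ
open import Data.List using (List; []; _∷_; length; map; foldr; cartesianProduct)
open import Data.List.Membership.Propositional using (_∈_; lose)
open import Data.List.Membership.Propositional.Properties using (∈-map⁺; ∈-cartesianProduct⁺)
open import Data.List.Membership.Propositional.Properties.WithK using (unique∧set⇒bag)
open import Data.List.Relation.Binary.BagAndSetEquality using (∼bag⇒↭)
open import Data.List.Relation.Binary.Permutation.Propositional using (_↭_; ↭⇒↭ₛ)
import Data.List.Relation.Binary.Permutation.Setoid.Properties as ↭ₛ
import Data.List.Relation.Unary.All as All
open import Data.List.Relation.Unary.AllPairs using ([]; _∷_)
open import Data.List.Relation.Unary.Any as Any using (Any; here; there)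
open import Data.List.Relation.Unary.Unique.Propositional using (Unique)
import Data.List.Relation.Unary.Unique.Propositional.Properties as Uniqueₚ
open import Data.Maybe using (Maybe; just; nothing)
open import Data.Nat as ℕ using (ℕ; zero; suc; _≤_; _<_; z≤n; s≤s)
open import Data.Nat.Coprimality using (Coprime; coprime-Bézout)
import Data.Nat.DivMod as ℕᵈ
open import Data.Nat.Divisibility using (_∣_; ∣1⇒≡1)
open import Data.Nat.GCD using (module Bézout)
open import Data.Nat.Primality using (Prime; prime?; euclidsLemma; prime⇒irreducible; ¬prime[1])
import Data.Nat.Properties as ℕₚ
open import Data.Product using (Σ; ∃; _×_; _,_; proj₁; proj₂; swap)
open import Data.Product.Properties using (≡-dec)
open import Data.Product.Relation.Binary.Pointwise.NonDependent using (Pointwise; ×-isEquivalence)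
open import Data.Sum using (_⊎_; inj₁; inj₂; [_,_])
open import Data.Unit using (⊤; tt)
open import Data.Vec using (Vec; []; _∷_; lookup; tabulate)
open import Data.Vec.Properties using (lookup∘tabulate)
open import Function using (_∘_; case_of_; mk⇔; _↔_; Inverse)
open import Function.Construct.Identity using (↔-id)
open import Relation.Binary using (IsEquivalence; Reflexive; Symmetric; Transitive; Decidable; tri<; tri≈; tri>)
open import Relation.Binary.PropositionalEquality as ≡ using (_≡_; _≢_; refl; sym; trans; cong; cong₂; subst; subst₂; isEquivalence; module ≡-Reasoning)
open import Relation.Nullary using (¬_; Dec; yes; no; ¬?; _×-dec_)
open import Relation.Nullary.Decidable using (from-yes; map′)

-- After one point is moved to `e₁`, the determinant with it is the second coordinate, which a shear
-- leaves alone. The vertices of T are normalised accordingly: second coordinate 0 at `e₁`, 1 at its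
-- four neighbours, 1 - i at its antipode. No two of these differ by a power of i, so a given point
-- can meet the blocks `shear t` at one kind of vertex only, and its first coordinate then leaves a
-- linear equation for t. In characteristic 5, (1 - i)⁴ = 1 makes 1 - i itself a power of i, and
-- adjacent and antipodal pairs fall into one orbit. Neither P nor G is formed as a quotient:
-- everything is counted modulo an equivalence. Where a number is not known in advance, decidable
-- search through a finite list shows that it exists, and comparison with another count then gives
-- its value. In this way b is found without the order of G or of a stabiliser.

module Counting where

  private
    variable
      X Y : Set
      R S : X → X → Set
      P Q : X → Set
      m n k l : ℕ

  -- The index type is any `A` in bijection with `Fin n`, so that representatives may be indexed by
  -- sums and products of finite types.
  count-by : {A : Set} → Fin n ↔ A → (f : A → X) → (∀ a → Q (f a)) →
             (∀ a b → R (f a) (f b) → a ≡ b) → (∀ x → Q x → ∃ λ a → R x (f a)) →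
             Count R Q n
  count-by {Q = Q} {R = R} A↔ f Qf inj cover = tabulate g ,
    (λ j → subst Q (sym (lookup∘tabulate g j)) (Qf (to j))) ,
    (λ j j' r → to-injective (inj _ _
       (subst₂ R (lookup∘tabulate g j) (lookup∘tabulate g j') r))) ,
    (λ x q → let (a , r) = cover x q in
       from a , subst (R x)
         (trans (cong f (sym (strictlyInverseˡ a))) (sym (lookup∘tabulate g (from a)))) r)
    where
    open Inverse A↔ using (to; from; strictlyInverseˡ; strictlyInverseʳ)
    g = f ∘ to
    to-injective : ∀ {j j'} → to j ≡ to j' → j ≡ j'
    to-injective {j} {j'} eq =
      trans (sym (strictlyInverseʳ j)) (trans (cong from eq) (strictlyInverseʳ j'))

  -- `f` need not respect `R`: sending each representative to the index of the class of its image is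
  -- injective as soon as `f` reflects equivalence.
  count-≤ : IsEquivalence S → (f : X → Y) → (∀ x → P x → Q (f x)) →
            (∀ x y → P x → P y → S (f x) (f y) → R x y) →
            Count R P m → Count S Q n → m ≤ n
  count-≤ {S = S} {R = R} S-equiv f fP f-reflects (r , rP , r-inj , _) (s , _ , _ , s-cover) =
    injective⇒≤ {f = ι} ι-injective
    where
    open IsEquivalence S-equiv using () renaming (sym to S-sym; trans to S-trans)
    image = λ j → s-cover (f (lookup r j)) (fP _ (rP j))
    ι = λ j → proj₁ (image j)
    ι-injective : ∀ {j j'} → ι j ≡ ι j' → j ≡ j'
    ι-injective {j} {j'} eq = r-inj j j' (f-reflects _ _ (rP j) (rP j')
      (S-trans (proj₂ (image j))
        (subst (λ x → S (lookup s x) _) (sym eq) (S-sym (proj₂ (image j'))))))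

  count-unique : IsEquivalence R → Count R Q m → Count R Q n → m ≡ n
  count-unique equiv c d = ℕₚ.≤-antisym
    (count-≤ equiv (λ x → x) (λ _ q → q) (λ _ _ _ _ r → r) c d)
    (count-≤ equiv (λ x → x) (λ _ q → q) (λ _ _ _ _ r → r) d c)

  count-cons : IsEquivalence R → (x₀ : X) → Q x₀ → (∀ x → P x → Q x × ¬ R x x₀) →
               (∀ x → Q x → R x x₀ ⊎ P x) → Count R P n → Count R Q (suc n)
  count-cons {R = R} {Q = Q} equiv x₀ q₀ P⇒ Q⇒ (r , rP , r-inj , r-cover) =
    x₀ ∷ r , rQ , inj , (λ x q → cover x (Q⇒ x q))
    where
    open IsEquivalence equiv using () renaming (sym to R-sym)
    rQ : ∀ j → Q (lookup (x₀ ∷ r) j)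
    rQ zero = q₀
    rQ (suc j) = proj₁ (P⇒ _ (rP j))
    inj : ∀ j j' → R (lookup (x₀ ∷ r) j) (lookup (x₀ ∷ r) j') → j ≡ j'
    inj zero zero _ = refl
    inj zero (suc j') e = ⊥-elim (proj₂ (P⇒ _ (rP j')) (R-sym e))
    inj (suc j) zero e = ⊥-elim (proj₂ (P⇒ _ (rP j)) e)
    inj (suc j) (suc j') e = cong suc (r-inj j j' e)
    cover : ∀ x → R x x₀ ⊎ _ → ∃ λ j → R x (lookup (x₀ ∷ r) j)
    cover x (inj₁ e) = zero , e
    cover x (inj₂ p) = let (j , e) = r-cover x p in suc j , e

  -- A candidate from the list becomes a representative if it satisfies `Q`; its whole class is then
  -- removed from `Q` before the rest of the list is examined.
  count-exists : IsEquivalence R → Decidable R → (∀ x → Dec (Q x)) →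
                 (∀ x y → R x y → Q x → Q y) →
                 (xs : List X) → (∀ x → Q x → Any (R x) xs) → ∃ (Count R Q)
  count-exists equiv R? Q? resp [] covers =
    0 , [] , (λ ()) , (λ ()) , λ x q → case covers x q of λ ()
  count-exists {R = R} {Q = Q} equiv R? Q? resp (x₀ ∷ xs) covers with Q? x₀
  ... | no ¬q₀ = count-exists equiv R? Q? resp xs (λ x q → tail x q (covers x q))
    where
    tail : ∀ x → Q x → Any (R x) (x₀ ∷ xs) → Any (R x) xs
    tail x q (here e) = ⊥-elim (¬q₀ (resp x x₀ e q))
    tail x q (there e) = e
  ... | yes q₀ = let (n , c) = rest in suc n , count-cons equiv x₀ q₀ (λ _ p → p) split c
    where
    open IsEquivalence equiv using () renaming (sym to R-sym; trans to R-trans)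
    Q' = λ x → Q x × ¬ R x x₀
    tail : ∀ x → Q' x → Any (R x) (x₀ ∷ xs) → Any (R x) xs
    tail x (_ , ¬e) (here e) = ⊥-elim (¬e e)
    tail x _ (there e) = e
    rest = count-exists {Q = Q'} equiv R? (λ x → Q? x ×-dec ¬? (R? x x₀))
      (λ x y e (q , ¬e) → resp x y e q , λ e' → ¬e (R-trans e e'))
      xs (λ x q' → tail x q' (covers x (proj₁ q')))
    split : ∀ x → Q x → R x x₀ ⊎ Q' x
    split x q with R? x x₀
    ... | yes e = inj₁ e
    ... | no ¬e = inj₂ (q , ¬e)

  count-map : IsEquivalence S → (f : X → Y) → (∀ x → P x → Q (f x)) →
              (∀ x y → R x y → S (f x) (f y)) →
              (∀ x y → P x → P y → S (f x) (f y) → R x y) →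
              (∀ y → Q y → ∃ λ x → P x × S y (f x)) →
              Count R P n → Count S Q n
  count-map {S = S} equiv f fP f-cong f-reflects preimage (r , rP , r-inj , r-cover) =
    count-by {R = S} (↔-id _) (f ∘ lookup r) (λ j → fP _ (rP j))
      (λ j j' e → r-inj j j' (f-reflects _ _ (rP j) (rP j') e))
      (λ y q → let (x , p , y≈fx) = preimage y q
                   (j , e) = r-cover x p
               in j , S-trans y≈fx (f-cong _ _ e))
    where open IsEquivalence equiv using () renaming (trans to S-trans)

  count-⊎ : IsEquivalence R → (∀ x y → P x → Q y → ¬ R x y) →
            Count R P m → Count R Q n → Count R (λ x → P x ⊎ Q x) (m ℕ.+ n)
  count-⊎ {R = R} {m = m} {n = n} equiv disjoint
          (r , rP , r-inj , r-cover) (s , sQ , s-inj , s-cover) =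
    count-by {R = R} (+↔⊎ {m} {n}) [ lookup r , lookup s ]
      (λ { (inj₁ j) → inj₁ (rP j) ; (inj₂ j) → inj₂ (sQ j) })
      (λ { (inj₁ j) (inj₁ j') e → cong inj₁ (r-inj j j' e)
         ; (inj₁ j) (inj₂ j') e → ⊥-elim (disjoint _ _ (rP j) (sQ j') e)
         ; (inj₂ j) (inj₁ j') e → ⊥-elim (disjoint _ _ (rP j') (sQ j) (R-sym e))
         ; (inj₂ j) (inj₂ j') e → cong inj₂ (s-inj j j' e) })
      (λ { x (inj₁ p) → let (j , e) = r-cover x p in inj₁ j , e
         ; x (inj₂ q) → let (j , e) = s-cover x q in inj₂ j , e })
    where open IsEquivalence equiv using () renaming (sym to R-sym)

  count-Σ : {I : X → Y → Set} → (∀ x x' y → R x x' → I x y → I x' y) →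
            Count R P m → (∀ x → P x → Count S (I x) k) →
            Count (Pointwise R S) (λ (x , y) → P x × I x y) (m ℕ.* k)
  count-Σ {R = R} {m = m} {S = S} {k = k} resp (r , rP , r-inj , r-cover) fibre =
    count-by {R = Pointwise R S} (*↔× {m} {k}) (λ (j , l) → lookup r j , lookup (proj₁ (fib j)) l)
      (λ (j , l) → rP j , proj₁ (proj₂ (fib j)) l)
      (λ { (j , l) (j' , l') (e , e') → inj j l j' l' (r-inj j j' e) e' })
      (λ (x , y) (p , i) → let (j , e) = r-cover x p
                               (l , e') = proj₂ (proj₂ (proj₂ (fib j))) y (resp _ _ _ e i)
                           in (j , l) , (e , e'))
    where
    fib = λ j → fibre (lookup r j) (rP j)
    inj : ∀ j l j' l' → j ≡ j' → S (lookup (proj₁ (fib j)) l) (lookup (proj₁ (fib j')) l') →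
          (j , l) ≡ (j' , l')
    inj j l .j l' refl e' = cong (j ,_) (proj₁ (proj₂ (proj₂ (fib j))) l l' e')

  -- Both products count the pairs (x, y) with `I x y`, and exchanging the coordinates compares the
  -- two counts in both directions.
  double-count : {I : X → Y → Set} → IsEquivalence R → IsEquivalence S →
                 (∀ x y → I x y → P x × Q y) →
                 (∀ x x' y → R x x' → I x y → I x' y) →
                 (∀ x y y' → S y y' → I x y → I x y') →
                 Count R P m → (∀ x → P x → Count S (I x) k) →
                 Count S Q n → (∀ y → Q y → Count R (λ x → I x y) l) →
                 m ℕ.* k ≡ n ℕ.* l
  double-count {R = R} {S = S} R-equiv S-equiv I⇒ respˡ respʳ cP fibP cQ fibQ =
    ℕₚ.≤-antisym
      (count-≤ (×-isEquivalence S-equiv R-equiv) swap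
        (λ (x , y) (_ , i) → proj₂ (I⇒ x y i) , i) (λ _ _ _ _ → swap) cPI cQI)
      (count-≤ (×-isEquivalence R-equiv S-equiv) swap
        (λ (y , x) (_ , i) → proj₁ (I⇒ x y i) , i) (λ _ _ _ _ → swap) cQI cPI)
    where
    cPI = count-Σ {R = R} {S = S} respˡ cP fibP
    cQI = count-Σ {R = S} {S = R} (λ y y' x → respʳ x y y') cQ fibQ

open Counting

-- Ring identities with coefficients in the Gaussian integers.

module GaussianSolver {c ℓ} (R : CommutativeRing c ℓ) (i : CommutativeRing.Carrier R)
  (i²≈-1 : CommutativeRing._≈_ R (CommutativeRing._*_ R i i)
             (CommutativeRing.-_ R (CommutativeRing.1# R))) where

  open import Data.Integer as ℤ using (ℤ; +_; -[1+_]; _⊖_)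
  open CommutativeRing R renaming (refl to ≈-refl; sym to ≈-sym; trans to ≈-trans)
  open import Algebra.Properties.Ring ring
  open import Algebra.Properties.AbelianGroup +-abelianGroup using (⁻¹-∙-comm)
  open import Algebra.Properties.Semiring.Mult.TCOptimised semiring
    using (1+×; ×-homo-+; ×1-homo-*) renaming (_×_ to _·_)
  open import Algebra.Properties.CommutativeSemigroup +-commutativeSemigroup
    using (interchange)
  open import Relation.Binary.Reasoning.Setoid setoid

  fromℤ : ℤ → Carrier
  fromℤ (+ n) = n · 1#
  fromℤ -[1+ n ] = - (suc n · 1#)

  fromℤ-⊖ : ∀ m n → fromℤ (m ⊖ n) ≈ m · 1# - n · 1#
  fromℤ-⊖ m zero = begin
    m · 1#        ≈⟨ +-identityʳ _ ⟨
    m · 1# + 0#   ≈⟨ +-congˡ -0#≈0# ⟨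
    m · 1# - 0#   ∎
  fromℤ-⊖ zero (suc n) = ≈-sym (+-identityˡ _)
  fromℤ-⊖ (suc m) (suc n) = begin
    fromℤ (suc m ⊖ suc n)               ≡⟨ cong fromℤ (ℤₚ.[1+m]⊖[1+n]≡m⊖n m n) ⟩
    fromℤ (m ⊖ n)                       ≈⟨ fromℤ-⊖ m n ⟩
    m · 1# - n · 1#                     ≈⟨ +-identityˡ _ ⟨
    0# + (m · 1# - n · 1#)              ≈⟨ +-congʳ (-‿inverseʳ 1#) ⟨
    (1# - 1#) + (m · 1# - n · 1#)       ≈⟨ interchange _ _ _ _ ⟩
    (1# + m · 1#) + (- 1# - n · 1#)     ≈⟨ +-cong (1+× m 1#)
                                             (≈-trans (-‿cong (1+× n 1#)) (≈-sym (⁻¹-∙-comm _ _))) ⟨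
    suc m · 1# - suc n · 1#             ∎

  fromℤ-+ : ∀ x y → fromℤ (x ℤ.+ y) ≈ fromℤ x + fromℤ y
  fromℤ-+ (+ m) (+ n) = ×-homo-+ 1# m n
  fromℤ-+ (+ m) -[1+ n ] = fromℤ-⊖ m (suc n)
  fromℤ-+ -[1+ m ] (+ n) = ≈-trans (fromℤ-⊖ n (suc m)) (+-comm _ _)
  fromℤ-+ -[1+ m ] -[1+ n ] = begin
    - (suc (suc (m ℕ.+ n)) · 1#)      ≡⟨ cong (λ k → - (suc k · 1#)) (+-suc m n) ⟨
    - ((suc m ℕ.+ suc n) · 1#)        ≈⟨ -‿cong (×-homo-+ 1# (suc m) (suc n)) ⟩
    - (suc m · 1# + suc n · 1#)       ≈⟨ ⁻¹-∙-comm _ _ ⟨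
    - (suc m · 1#) - (suc n · 1#)     ∎
    where open import Data.Nat.Properties using (+-suc)

  fromℤ-neg : ∀ x → fromℤ (ℤ.- x) ≈ - fromℤ x
  fromℤ-neg (+ zero) = ≈-sym -0#≈0#
  fromℤ-neg (+ suc n) = ≈-refl
  fromℤ-neg -[1+ n ] = ≈-sym (-‿involutive _)

  fromℤ-*⁺ : ∀ x n → fromℤ (x ℤ.* + n) ≈ fromℤ x * (n · 1#)
  fromℤ-*⁺ (+ m) n = ≈-trans (reflexive (cong fromℤ (sym (ℤₚ.pos-* m n)))) (×1-homo-* m n)
  fromℤ-*⁺ -[1+ m ] n = begin
    fromℤ (-[1+ m ] ℤ.* + n)         ≡⟨ cong fromℤ (ℤₚ.neg-distribˡ-* (+ suc m) (+ n)) ⟨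
    fromℤ (ℤ.- (+ suc m ℤ.* + n))    ≈⟨ fromℤ-neg (+ suc m ℤ.* + n) ⟩
    - fromℤ (+ suc m ℤ.* + n)        ≈⟨ -‿cong (fromℤ-*⁺ (+ suc m) n) ⟩
    - (suc m · 1# * (n · 1#))        ≈⟨ -‿distribˡ-* _ _ ⟩
    - (suc m · 1#) * (n · 1#)        ∎

  fromℤ-* : ∀ x y → fromℤ (x ℤ.* y) ≈ fromℤ x * fromℤ y
  fromℤ-* x (+ n) = fromℤ-*⁺ x n
  fromℤ-* x -[1+ n ] = begin
    fromℤ (x ℤ.* -[1+ n ])           ≡⟨ cong fromℤ (ℤₚ.neg-distribʳ-* x (+ suc n)) ⟨
    fromℤ (ℤ.- (x ℤ.* + suc n))      ≈⟨ fromℤ-neg (x ℤ.* + suc n) ⟩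
    - fromℤ (x ℤ.* + suc n)          ≈⟨ -‿cong (fromℤ-*⁺ x (suc n)) ⟩
    - (fromℤ x * (suc n · 1#))       ≈⟨ -‿distribʳ-* _ _ ⟩
    fromℤ x * - (suc n · 1#)         ∎

  -- The special cases make the coefficients 0, 1 and i denote 0#, 1# and i on the nose.
  fromℤ[i] : ℤ × ℤ → Carrier
  fromℤ[i] (a , + 0) = fromℤ a
  fromℤ[i] (+ 0 , + 1) = i
  fromℤ[i] (a , b) = fromℤ a + fromℤ b * i

  fromℤ[i]-≈ : ∀ a b → fromℤ[i] (a , b) ≈ fromℤ a + fromℤ b * i
  fromℤ[i]-≈ a (+ 0) = ≈-sym (≈-trans (+-congˡ (zeroˡ i)) (+-identityʳ _))
  fromℤ[i]-≈ (+ 0) (+ 1) = ≈-sym (≈-trans (+-identityˡ _) (*-identityˡ i))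
  fromℤ[i]-≈ (+ suc a) (+ 1) = ≈-refl
  fromℤ[i]-≈ -[1+ a ] (+ 1) = ≈-refl
  fromℤ[i]-≈ (+ 0) (+ suc (suc b)) = ≈-refl
  fromℤ[i]-≈ (+ suc a) (+ suc (suc b)) = ≈-refl
  fromℤ[i]-≈ -[1+ a ] (+ suc (suc b)) = ≈-refl
  fromℤ[i]-≈ (+ 0) -[1+ b ] = ≈-refl
  fromℤ[i]-≈ (+ suc a) -[1+ b ] = ≈-refl
  fromℤ[i]-≈ -[1+ a ] -[1+ b ] = ≈-refl

  -- Over ℤ[i] instead of ℤ the relation i² = -1 is part of the coefficient arithmetic, so the
  -- solver proves identities that hold only because of it.
  ℤ[i] : RawRing 0ℓ 0ℓ
  ℤ[i] = record
    { Carrier = ℤ × ℤ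
    ; _≈_ = _≡_
    ; _+_ = λ (a , b) (c , d) → a ℤ.+ c , b ℤ.+ d
    ; _*_ = λ (a , b) (c , d) → a ℤ.* c ℤ.- b ℤ.* d , a ℤ.* d ℤ.+ b ℤ.* c
    ; -_ = λ (a , b) → ℤ.- a , ℤ.- b
    ; 0# = + 0 , + 0
    ; 1# = + 1 , + 0
    }

  product : ∀ a b c d → (a + b * i) * (c + d * i) ≈ (a * c - b * d) + (a * d + b * c) * i
  product a b c d = begin
    (a + b * i) * (c + d * i)
      ≈⟨ ≈-trans (distribʳ _ _ _) (+-cong (distribˡ _ _ _) (distribˡ _ _ _)) ⟩
    (a * c + a * (d * i)) + (b * i * c + b * i * (d * i))
      ≈⟨ +-congˡ (+-comm _ _) ⟩
    (a * c + a * (d * i)) + (b * i * (d * i) + b * i * c)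
      ≈⟨ interchange _ _ _ _ ⟩
    (a * c + b * i * (d * i)) + (a * (d * i) + b * i * c)
      ≈⟨ +-cong (+-congˡ real) (+-cong (≈-sym (*-assoc _ _ _)) imag) ⟩
    (a * c - b * d) + (a * d * i + b * c * i)
      ≈⟨ +-congˡ (distribʳ _ _ _) ⟨
    (a * c - b * d) + (a * d + b * c) * i  ∎
    where
    open import Algebra.Properties.CommutativeSemigroup *-commutativeSemigroup
      using (xy∙z≈xz∙y) renaming (interchange to *-interchange)
    imag = xy∙z≈xz∙y b i c
    real : b * i * (d * i) ≈ - (b * d)
    real = begin
      b * i * (d * i)    ≈⟨ *-interchange _ _ _ _ ⟩
      b * d * (i * i)    ≈⟨ *-congˡ i²≈-1 ⟩
      b * d * - 1#       ≈⟨ -‿distribʳ-* _ _ ⟨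
      - (b * d * 1#)     ≈⟨ -‿cong (*-identityʳ _) ⟩
      - (b * d)          ∎

  fromℤ[i]-homomorphism : ℤ[i] -Raw-AlmostCommutative⟶ fromCommutativeRing R
  fromℤ[i]-homomorphism = record
    { ⟦_⟧ = fromℤ[i]
    ; +-homo = λ (a , b) (c , d) → begin
        fromℤ[i] (a ℤ.+ c , b ℤ.+ d)
          ≈⟨ fromℤ[i]-≈ (a ℤ.+ c) (b ℤ.+ d) ⟩
        fromℤ (a ℤ.+ c) + fromℤ (b ℤ.+ d) * i
          ≈⟨ +-cong (fromℤ-+ a c) (≈-trans (*-congʳ (fromℤ-+ b d)) (distribʳ _ _ _)) ⟩
        (fromℤ a + fromℤ c) + (fromℤ b * i + fromℤ d * i)
          ≈⟨ interchange _ _ _ _ ⟩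
        (fromℤ a + fromℤ b * i) + (fromℤ c + fromℤ d * i)
          ≈⟨ +-cong (fromℤ[i]-≈ a b) (fromℤ[i]-≈ c d) ⟨
        fromℤ[i] (a , b) + fromℤ[i] (c , d)  ∎
    ; *-homo = λ (a , b) (c , d) → begin
        fromℤ[i] (a ℤ.* c ℤ.- b ℤ.* d , a ℤ.* d ℤ.+ b ℤ.* c)
          ≈⟨ fromℤ[i]-≈ (a ℤ.* c ℤ.- b ℤ.* d) (a ℤ.* d ℤ.+ b ℤ.* c) ⟩
        fromℤ (a ℤ.* c ℤ.- b ℤ.* d) + fromℤ (a ℤ.* d ℤ.+ b ℤ.* c) * i
          ≈⟨ +-cong
               (≈-trans (fromℤ-+ (a ℤ.* c) (ℤ.- (b ℤ.* d)))
                 (+-cong (fromℤ-* a c)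
                   (≈-trans (fromℤ-neg (b ℤ.* d)) (-‿cong (fromℤ-* b d)))))
               (*-congʳ (≈-trans (fromℤ-+ (a ℤ.* d) (b ℤ.* c))
                 (+-cong (fromℤ-* a d) (fromℤ-* b c)))) ⟩
        (fromℤ a * fromℤ c - fromℤ b * fromℤ d)
          + (fromℤ a * fromℤ d + fromℤ b * fromℤ c) * i
          ≈⟨ product _ _ _ _ ⟨
        (fromℤ a + fromℤ b * i) * (fromℤ c + fromℤ d * i)
          ≈⟨ *-cong (fromℤ[i]-≈ a b) (fromℤ[i]-≈ c d) ⟨
        fromℤ[i] (a , b) * fromℤ[i] (c , d)  ∎
    ; -‿homo = λ (a , b) → begin
        fromℤ[i] (ℤ.- a , ℤ.- b)
          ≈⟨ fromℤ[i]-≈ (ℤ.- a) (ℤ.- b) ⟩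
        fromℤ (ℤ.- a) + fromℤ (ℤ.- b) * i
          ≈⟨ +-cong (fromℤ-neg a)
               (≈-trans (*-congʳ (fromℤ-neg b)) (≈-sym (-‿distribˡ-* _ _))) ⟩
        - fromℤ a - fromℤ b * i
          ≈⟨ ⁻¹-∙-comm _ _ ⟩
        - (fromℤ a + fromℤ b * i)
          ≈⟨ -‿cong (fromℤ[i]-≈ a b) ⟨
        - fromℤ[i] (a , b)  ∎
    ; 0-homo = ≈-refl
    ; 1-homo = ≈-refl
    }

  _≟ᶜ_ : ∀ x y → Maybe (fromℤ[i] x ≈ fromℤ[i] y)
  x ≟ᶜ y with ≡-dec ℤ._≟_ ℤ._≟_ x y
  ... | yes x≡y = just (reflexive (cong fromℤ[i] x≡y))
  -- Distinct Gaussian integers may agree in characteristic p, so nothing can be concluded here.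
  ... | no _ = nothing

  open RingSolver ℤ[i] (fromCommutativeRing R) fromℤ[i]-homomorphism _≟ᶜ_ public
    using (Polynomial; prove; solve; con; _:=_; _:+_; _:*_; _:-_; :-_)

  :0 :1 :i : ∀ {n} → Polynomial n
  :0 = con (+ 0 , + 0)
  :1 = con (+ 1 , + 0)
  :i = con (+ 0 , + 1)

count-list : {X : Set} {xs : List X} → Unique xs → Count _≡_ (_∈ xs) (length xs)
count-list [] = [] , (λ ()) , (λ ()) , λ _ ()
count-list {xs = x ∷ xs} (x∉xs ∷ u) =
  count-cons isEquivalence x (here refl)
    (λ y y∈xs → there y∈xs , λ y≡x → All.lookup x∉xs y∈xs (sym y≡x))
    (λ { y (here y≡x) → inj₁ y≡x ; y (there y∈xs) → inj₂ y∈xs })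
    (count-list u)

prime∣^ : ∀ {r p} → Prime r → Prime p → ∀ α → r ∣ p ℕ.^ α → r ≡ p
prime∣^ {r} r-prime p-prime zero r∣1 =
  ⊥-elim (¬prime[1] (subst Prime (∣1⇒≡1 r∣1) r-prime))
prime∣^ {r} {p} r-prime p-prime (suc α) r∣ with euclidsLemma p (p ℕ.^ α) r-prime r∣
... | inj₂ r∣pᵅ = prime∣^ r-prime p-prime α r∣pᵅ
... | inj₁ r∣p with prime⇒irreducible p-prime r∣p
... | inj₁ r≡1 = ⊥-elim (¬prime[1] (subst Prime r≡1 r-prime))
... | inj₂ r≡p = r≡p

-- Arithmetic and characteristic of a finite field.

module FiniteFieldProperties (F : FiniteField) where
  open FiniteField F

  ring : CommutativeRing 0ℓ 0ℓ
  ring = record { isCommutativeRing = isCommutativeRing }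

  open CommutativeRing ring public using
    ( +-assoc; +-comm; +-identityˡ; +-identityʳ; -‿inverseˡ; -‿inverseʳ
    ; *-assoc; *-comm; *-identityˡ; *-identityʳ; zeroˡ; zeroʳ; distribˡ; distribʳ
    ; semiring; +-isCommutativeMonoid )
  open import Algebra.Properties.Ring (CommutativeRing.ring ring)
    using (-‿distribˡ-*; -‿distribʳ-*; +-cancelˡ; +-cancelʳ; +-inverseˡ-unique)
  open import Algebra.Properties.Semiring.Mult semiring
    using (×-homo-+; ×1-homo-*) renaming (_×_ to _·_)

  1≢0 : 1# ≢ 0#
  1≢0 = 0≢1 ∘ sym

  *-cancelˡ : ∀ {x y z} → x ≢ 0# → x * y ≡ x * z → y ≡ z
  *-cancelˡ {x} {y} {z} x≢0 eq = begin
    y                ≡⟨ *-identityˡ y ⟨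
    1# * y           ≡⟨ cong (_* y) x⁻¹x ⟨
    x⁻¹ * x * y      ≡⟨ *-assoc x⁻¹ x y ⟩
    x⁻¹ * (x * y)    ≡⟨ cong (x⁻¹ *_) eq ⟩
    x⁻¹ * (x * z)    ≡⟨ *-assoc x⁻¹ x z ⟨
    x⁻¹ * x * z      ≡⟨ cong (_* z) x⁻¹x ⟩
    1# * z           ≡⟨ *-identityˡ z ⟩
    z                ∎
    where
    open ≡-Reasoning
    x⁻¹ = proj₁ (inverse x x≢0)
    x⁻¹x = trans (*-comm x⁻¹ x) (proj₂ (inverse x x≢0))

  *-cancelʳ : ∀ {x y z} → x ≢ 0# → y * x ≡ z * x → y ≡ z
  *-cancelʳ {x} {y} {z} x≢0 eq = *-cancelˡ x≢0 (trans (*-comm x y) (trans eq (*-comm z x)))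

  x*y≡0⇒y≡0 : ∀ {x y} → x ≢ 0# → x * y ≡ 0# → y ≡ 0#
  x*y≡0⇒y≡0 {x} x≢0 eq = *-cancelˡ x≢0 (trans eq (sym (zeroʳ x)))

  ^-+ : ∀ x m n → x ^ (m ℕ.+ n) ≡ x ^ m * x ^ n
  ^-+ x zero n = sym (*-identityˡ _)
  ^-+ x (suc m) n = trans (cong (x *_) (^-+ x m n)) (sym (*-assoc x _ _))

  1^ : ∀ n → 1# ^ n ≡ 1#
  1^ zero = refl
  1^ (suc n) = trans (*-identityˡ _) (1^ n)

  ^-* : ∀ x m n → x ^ (m ℕ.* n) ≡ (x ^ n) ^ m
  ^-* x zero n = refl
  ^-* x (suc m) n = trans (^-+ x n (m ℕ.* n)) (cong (x ^ n *_) (^-* x m n))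

  ^≢0 : ∀ {x} n → x ≢ 0# → x ^ n ≢ 0#
  ^≢0 zero _ = 1≢0
  ^≢0 (suc n) x≢0 eq = ^≢0 n x≢0 (x*y≡0⇒y≡0 x≢0 eq)

  ^-% : ∀ {x} d .{{_ : ℕ.NonZero d}} → x ^ d ≡ 1# → ∀ n → x ^ n ≡ x ^ (n ℕ.% d)
  ^-% {x} d xᵈ≡1 n = begin
    x ^ n                                  ≡⟨ cong (x ^_) (ℕᵈ.m≡m%n+[m/n]*n n d) ⟩
    x ^ (n ℕ.% d ℕ.+ (n ℕ./ d) ℕ.* d)        ≡⟨ ^-+ x (n ℕ.% d) _ ⟩
    x ^ (n ℕ.% d) * x ^ ((n ℕ./ d) ℕ.* d)    ≡⟨ cong (x ^ (n ℕ.% d) *_)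
        (trans (^-* x (n ℕ./ d) d) (trans (cong (_^ (n ℕ./ d)) xᵈ≡1) (1^ (n ℕ./ d)))) ⟩
    x ^ (n ℕ.% d) * 1#                     ≡⟨ *-identityʳ _ ⟩
    x ^ (n ℕ.% d)                          ∎
    where open ≡-Reasoning

  ^-cancel : ∀ {x} m n → x ≢ 0# → m < n → x ^ m ≡ x ^ n → x ^ (n ℕ.∸ m) ≡ 1#
  ^-cancel {x} m n x≢0 m<n eq = *-cancelˡ (^≢0 m x≢0) (begin
    x ^ m * x ^ (n ℕ.∸ m)     ≡⟨ ^-+ x m (n ℕ.∸ m) ⟨
    x ^ (m ℕ.+ (n ℕ.∸ m))     ≡⟨ cong (x ^_) (ℕₚ.m+[n∸m]≡n (ℕₚ.<⇒≤ m<n)) ⟩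
    x ^ n                     ≡⟨ eq ⟨
    x ^ m                     ≡⟨ *-identityʳ _ ⟨
    x ^ m * 1#                ∎)
    where open ≡-Reasoning

  ^-injective : ∀ {x M} → x ≢ 0# → (∀ d → 0 < d → x ^ d ≡ 1# → M ≤ d) →
                ∀ m n → m < M → n < M → x ^ m ≡ x ^ n → m ≡ n
  ^-injective {x} {M} x≢0 minimal m n m<M n<M eq with ℕₚ.<-cmp m n
  ... | tri≈ _ m≡n _ = m≡n
  ... | tri< m<n _ _ = ⊥-elim (ℕₚ.<⇒≱ (ℕₚ.≤-<-trans (ℕₚ.m∸n≤m n m) n<M)
          (minimal (n ℕ.∸ m) (ℕₚ.m<n⇒0<n∸m m<n) (^-cancel m n x≢0 m<n eq)))
  ... | tri> _ _ n<m = ⊥-elim (ℕₚ.<⇒≱ (ℕₚ.≤-<-trans (ℕₚ.m∸n≤m m n) m<M)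
          (minimal (m ℕ.∸ n) (ℕₚ.m<n⇒0<n∸m n<m) (^-cancel n m x≢0 n<m (sym eq))))

  count-elements : Count _≡_ (λ (_ : Carrier) → ⊤) order
  count-elements =
    count-map isEquivalence (λ x → x) (λ _ _ → tt) (λ _ _ e → e) (λ _ _ _ _ e → e)
      (λ x _ → x , elements-complete x , refl) (count-list elements-unique)

  count-nonzero : ∃ λ n → order ≡ suc n × Count _≡_ (λ x → x ≢ 0#) n
  count-nonzero = n , count-unique isEquivalence count-elements all , c
    where
    nonzeros = count-exists isEquivalence _≟_ (λ x → ¬? (x ≟ 0#)) (λ { _ _ refl q → q })
      elements (λ x _ → elements-complete x)
    n = proj₁ nonzeros
    c = proj₂ nonzeros
    split : ∀ x → ⊤ → x ≡ 0# ⊎ x ≢ 0#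
    split x _ with x ≟ 0#
    ... | yes e = inj₁ e
    ... | no e = inj₂ e
    all = count-cons isEquivalence 0# tt (λ _ e → tt , e) split c

  ∑ : List Carrier → Carrier
  ∑ = foldr _+_ 0#

  ∑-translate : ∀ xs → ∑ (map (1# +_) xs) ≡ length xs · 1# + ∑ xs
  ∑-translate [] = sym (+-identityˡ 0#)
  ∑-translate (x ∷ xs) =
    trans (cong (1# + x +_) (∑-translate xs)) (interchange 1# x (length xs · 1#) (∑ xs))
    where
    open import Algebra.Properties.CommutativeSemigroup
      (CommutativeRing.+-commutativeSemigroup ring) using (interchange)

  -- Translation by 1 permutes the field, so it preserves the sum of all elements.
  order·1≡0 : order · 1# ≡ 0#
  order·1≡0 = +-cancelʳ (∑ elements) _ _ (begin
    order · 1# + ∑ elements      ≡⟨ ∑-translate elements ⟨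
    ∑ (map (1# +_) elements)     ≡⟨ ↭ₛ.foldr-commMonoid (≡.setoid Carrier) +-isCommutativeMonoid
                                      (↭⇒↭ₛ permuted) ⟩
    ∑ elements                   ≡⟨ +-identityˡ _ ⟨
    0# + ∑ elements              ∎)
    where
    open ≡-Reasoning
    unshift : ∀ x → 1# + (- 1# + x) ≡ x
    unshift x = trans (sym (+-assoc _ _ _))
      (trans (cong (_+ x) (-‿inverseʳ 1#)) (+-identityˡ x))
    permuted : map (1# +_) elements ↭ elements
    permuted = ∼bag⇒↭ (unique∧set⇒bag
      (Uniqueₚ.map⁺ (+-cancelˡ 1# _ _) elements-unique) elements-unique
      (λ {x} → mk⇔ (λ _ → elements-complete x)
        (λ _ → subst (_∈ _) (unshift x) (∈-map⁺ (1# +_) (elements-complete (- 1# + x))))))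

  multiple : ∀ k {n} → n · 1# ≡ 0# → (k ℕ.* n) · 1# ≡ 0#
  multiple k {n} e = trans (×1-homo-* k n) (trans (cong (k · 1# *_) e) (zeroʳ _))

  -- In the Bézout identity for `m` and `order` both products annihilate 1, the one by assumption
  -- and the other by `order·1≡0`, which leaves 1 = 0.
  coprime·1≢0 : ∀ {m} → Coprime m order → m · 1# ≢ 0#
  coprime·1≢0 {m} coprime m·1≡0 with coprime-Bézout coprime
  ... | Bézout.+- x y eq = 1≢0 (begin
    1#                               ≡⟨ +-identityʳ 1# ⟨
    1# + 0#                          ≡⟨ cong (1# +_) (multiple y order·1≡0) ⟨
    suc (y ℕ.* order) · 1#           ≡⟨ cong (_· 1#) eq ⟩
    (x ℕ.* m) · 1#                   ≡⟨ multiple x m·1≡0 ⟩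
    0#                               ∎)
    where open ≡-Reasoning
  ... | Bézout.-+ x y eq = 1≢0 (begin
    1#                               ≡⟨ +-identityʳ 1# ⟨
    1# + 0#                          ≡⟨ cong (1# +_) (multiple x m·1≡0) ⟨
    suc (x ℕ.* m) · 1#               ≡⟨ cong (_· 1#) eq ⟩
    (y ℕ.* order) · 1#               ≡⟨ multiple y order·1≡0 ⟩
    0#                               ∎)
    where open ≡-Reasoning

  -- A common divisor of 5 and p^α is 1 or 5, and 5 divides p^α only if p = 5. The term `5 · 1#`
  -- unfolds to the sum that `Design` takes as its parameter.
  5·1≢0 : ∀ {p} α → Prime p → order ≡ p ℕ.^ α → p ≢ 5 → 5 · 1# ≢ 0#
  5·1≢0 α p-prime order≡ p≢5 = coprime·1≢0 coprime
    where
    5-prime = from-yes (prime? 5)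
    coprime : Coprime 5 order
    coprime (d∣5 , d∣q) with prime⇒irreducible 5-prime d∣5
    ... | inj₁ d≡1 = d≡1
    ... | inj₂ d≡5 = ⊥-elim (p≢5 (sym (prime∣^ 5-prime p-prime α (subst₂ _∣_ d≡5 order≡ d∣q))))

  -- The cyclic multiplicative group and its element i of order 4.

  module Generator (ω : Carrier) (generates : Geometry.IsGenerator F ω) (q%4≡1 : order ℕ.% 4 ≡ 1) where

    open Geometry.WithGenerator F ω using (i)

    N n : ℕ
    N = (order ℕ.∸ 1) ℕ./ 4
    n = proj₁ count-nonzero

    order≡1+n : order ≡ suc n
    order≡1+n = proj₁ (proj₂ count-nonzero)

    n≡N*4 : n ≡ N ℕ.* 4
    n≡N*4 = begin
      n                         ≡⟨ n≡ ⟩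
      order ℕ./ 4 ℕ.* 4         ≡⟨ cong (ℕ._* 4) (ℕᵈ.m*n/n≡m (order ℕ./ 4) 4) ⟨
      (order ℕ./ 4 ℕ.* 4) ℕ./ 4 ℕ.* 4   ≡⟨ cong (λ k → k ℕ./ 4 ℕ.* 4) n≡ ⟨
      n ℕ./ 4 ℕ.* 4             ≡⟨ cong (λ k → (k ℕ.∸ 1) ℕ./ 4 ℕ.* 4) order≡1+n ⟨
      N ℕ.* 4                   ∎
      where
      open ≡-Reasoning
      n≡ : n ≡ order ℕ./ 4 ℕ.* 4
      n≡ = ℕₚ.suc-injective (trans (sym order≡1+n)
        (trans (ℕᵈ.m≡m%n+[m/n]*n order 4) (cong (ℕ._+ order ℕ./ 4 ℕ.* 4) q%4≡1)))

    nonzero = proj₂ (proj₂ count-nonzero)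

    index : ∀ x → x ≢ 0# → Fin n
    index x x≢0 = proj₁ (proj₂ (proj₂ (proj₂ nonzero)) x x≢0)

    index-injective : ∀ x y (x≢0 : x ≢ 0#) (y≢0 : y ≢ 0#) → index x x≢0 ≡ index y y≢0 → x ≡ y
    index-injective x y x≢0 y≢0 eq = trans (proj₂ (proj₂ (proj₂ (proj₂ nonzero)) x x≢0))
      (trans (cong (lookup (proj₁ nonzero)) eq)
        (sym (proj₂ (proj₂ (proj₂ (proj₂ nonzero)) y y≢0))))

    n≤-by-surjection : ∀ d (f : Fin d → Carrier) → (∀ x → x ≢ 0# → ∃ λ k → x ≡ f k) → n ≤ d
    n≤-by-surjection d f surj = Finₚ.injective⇒≤ {f = λ j → proj₁ (hit j)}
      (λ {j} {j'} eq → proj₁ (proj₂ (proj₂ nonzero)) j j'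
        (trans (proj₂ (hit j)) (trans (cong f eq) (sym (proj₂ (hit j'))))))
      where hit = λ j → surj (lookup (proj₁ nonzero) j) (proj₁ (proj₂ nonzero) j)

    0<N : 0 < N
    0<N with N | n≡N*4 | index 1# 1≢0
    ... | suc _ | _ | _ = s≤s z≤n
    ... | zero | n≡0 | k = ⊥-elim (Finₚ.¬Fin0 (subst Fin n≡0 k))

    -- `IsGenerator` does not exclude ω = 0 outright, but the powers of 0 are 0 and 1, so 1 would be
    -- the only nonzero element, while n is a positive multiple of 4.
    ω≢0 : ω ≢ 0#
    ω≢0 ω≡0 = ℕₚ.<⇒≱ 1<n (n≤-by-surjection 1 (λ _ → 1#) (λ x x≢0 → zero , only x x≢0))
      where
      1<n : 1 < n
      1<n = subst (1 <_) (sym n≡N*4) (ℕₚ.<-≤-trans (s≤s (s≤s z≤n)) (ℕₚ.*-monoˡ-≤ 4 0<N))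
      only : ∀ x → x ≢ 0# → x ≡ 1#
      only x x≢0 with generates x x≢0
      ... | zero , eq = eq
      ... | suc k , eq = ⊥-elim (x≢0 (trans eq (trans (cong (_* ω ^ k) ω≡0) (zeroˡ _))))

    -- If ω^d = 1, the first d powers of ω already exhaust the n nonzero elements.
    ω-order-minimal : ∀ d → 0 < d → ω ^ d ≡ 1# → n ≤ d
    ω-order-minimal (suc d) _ ωᵈ≡1 = n≤-by-surjection (suc d) (λ k → ω ^ toℕ k)
      λ x x≢0 → let (k , eq) = generates x x≢0 in
        Fin.fromℕ< (ℕᵈ.m%n<n k (suc d)) ,
        trans eq (trans (^-% (suc d) ωᵈ≡1 k) (cong (ω ^_) (sym (Finₚ.toℕ-fromℕ< (ℕᵈ.m%n<n k (suc d))))))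

    -- Among n + 1 powers two coincide; their exponents differ by a period of at most n, and
    -- minimality makes it equal to n.
    ω^n≡1 : ω ^ n ≡ 1#
    ω^n≡1 with Finₚ.pigeonhole (ℕₚ.n<1+n n) (λ k → index (ω ^ toℕ k) (^≢0 (toℕ k) ω≢0))
    ... | j , k , j<k , eq = subst (λ d → ω ^ d ≡ 1#)
      (ℕₚ.≤-antisym (ℕₚ.≤-trans (ℕₚ.m∸n≤m (toℕ k) (toℕ j)) (ℕₚ.≤-pred (Finₚ.toℕ<n k)))
        (ω-order-minimal _ (ℕₚ.m<n⇒0<n∸m j<k) periodic)) periodic
      where
      periodic = ^-cancel (toℕ j) (toℕ k) ω≢0 j<k (index-injective _ _ _ _ eq)

    i≢0 : i ≢ 0#
    i≢0 = ^≢0 N ω≢0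

    i^4≡1 : i ^ 4 ≡ 1#
    i^4≡1 = trans (sym (^-* ω 4 N))
      (subst (λ k → ω ^ k ≡ 1#) (trans n≡N*4 (ℕₚ.*-comm N 4)) ω^n≡1)

    i-order-minimal : ∀ d → 0 < d → i ^ d ≡ 1# → 4 ≤ d
    i-order-minimal (suc d) _ eq = ℕₚ.*-cancelʳ-≤ 4 (suc d) N {{ℕ.>-nonZero 0<N}}
      (subst (_≤ suc d ℕ.* N) (trans n≡N*4 (ℕₚ.*-comm N 4))
        (ω-order-minimal (suc d ℕ.* N) (ℕₚ.≤-trans 0<N (ℕₚ.m≤m+n N _))
          (trans (^-* ω (suc d) N) eq)))

    i^-injective : ∀ (j k : Fin 4) → i ^ toℕ j ≡ i ^ toℕ k → j ≡ k
    i^-injective j k eq = Finₚ.toℕ-injective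
      (^-injective i≢0 i-order-minimal _ _ (Finₚ.toℕ<n j) (Finₚ.toℕ<n k) eq)

    -- (i² - 1)(i² + 1) = i⁴ - 1 = 0, and i² = 1 would contradict the order of i. The computation is
    -- by hand because the solver over ℤ[i] takes this very equation as its input.
    i²≡-1 : i * i ≡ - 1#
    i²≡-1 = +-inverseˡ-unique (i * i) 1# (x*y≡0⇒y≡0 i²-1≢0 difference-of-squares)
      where
      i²-1≢0 : i * i + - 1# ≢ 0#
      i²-1≢0 eq with i-order-minimal 2 (s≤s z≤n)
        (trans (cong (i *_) (*-identityʳ i)) (+-cancelʳ (- 1#) _ _ (trans eq (sym (-‿inverseʳ 1#)))))
      ... | s≤s (s≤s ())
      y = i * i
      y*y≡1 : y * y ≡ 1#
      y*y≡1 = trans (*-assoc i i _) (trans (cong (λ z → i * (i * (i * z))) (sym (*-identityʳ i))) i^4≡1)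
      difference-of-squares : (y + - 1#) * (y + 1#) ≡ 0#
      difference-of-squares = begin
        (y + - 1#) * (y + 1#)                  ≡⟨ distribˡ _ y 1# ⟩
        (y + - 1#) * y + (y + - 1#) * 1#       ≡⟨ cong₂ _+_ (distribʳ y y (- 1#)) (*-identityʳ _) ⟩
        (y * y + - 1# * y) + (y + - 1#)        ≡⟨ cong₂ (λ s t → (s + t) + (y + - 1#)) y*y≡1
                                                    (trans (sym (-‿distribˡ-* 1# y)) (cong -_ (*-identityˡ y))) ⟩
        (1# + - y) + (y + - 1#)                ≡⟨ +-assoc 1# (- y) _ ⟩
        1# + (- y + (y + - 1#))                ≡⟨ cong (1# +_) (sym (+-assoc (- y) y _)) ⟩
        1# + ((- y + y) + - 1#)                ≡⟨ cong (λ s → 1# + (s + - 1#)) (-‿inverseˡ y) ⟩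
        1# + (0# + - 1#)                       ≡⟨ cong (1# +_) (+-identityˡ _) ⟩
        1# + - 1#                              ≡⟨ -‿inverseʳ 1# ⟩
        0#                                     ∎
        where open ≡-Reasoning

-- The geometry of P and of the block T.

module Octahedron (F : FiniteField) (ω : FiniteField.Carrier F)
  (generates : Geometry.IsGenerator F ω) (q%4≡1 : FiniteField.order F ℕ.% 4 ≡ 1) where

  open FiniteField F
  open Geometry F
  open WithGenerator ω
  open FiniteFieldProperties F
  open Generator ω generates q%4≡1 using (i≢0; i^4≡1; i^-injective; i²≡-1)
  open GaussianSolver ring i i²≡-1

  e₁ e₂ : V
  e₁ = 1# , 0#
  e₂ = 0# , 1#

  -- Scalars and the equivalence ~

  scale-scale : ∀ a b u → scale a (scale b u) ≡ scale (a * b) u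
  scale-scale a b (x , y) = cong₂ _,_ (sym (*-assoc a b x)) (sym (*-assoc a b y))

  scale-1 : ∀ u → scale 1# u ≡ u
  scale-1 (x , y) = cong₂ _,_ (*-identityˡ x) (*-identityˡ y)

  scale-comm : ∀ a b u → scale a (scale b u) ≡ scale b (scale a u)
  scale-comm a b u = trans (scale-scale a b u)
    (trans (cong (λ c → scale c u) (*-comm a b)) (sym (scale-scale b a u)))

  i^n^4≡1 : ∀ n → (i ^ n) ^ 4 ≡ 1#
  i^n^4≡1 n = begin
    (i ^ n) ^ 4       ≡⟨ ^-* i 4 n ⟨
    i ^ (4 ℕ.* n)     ≡⟨ cong (i ^_) (ℕₚ.*-comm 4 n) ⟩
    i ^ (n ℕ.* 4)     ≡⟨ ^-* i n 4 ⟩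
    (i ^ 4) ^ n       ≡⟨ cong (_^ n) i^4≡1 ⟩
    1# ^ n            ≡⟨ 1^ n ⟩
    1#                ∎
    where open ≡-Reasoning

  -- Exponents are natural numbers, so 3n stands in for -n modulo 4.
  i^-inverse : ∀ n → i ^ (3 ℕ.* n) * i ^ n ≡ 1#
  i^-inverse n = begin
    i ^ (3 ℕ.* n) * i ^ n     ≡⟨ *-comm _ _ ⟩
    i ^ n * i ^ (3 ℕ.* n)     ≡⟨ ^-+ i n (3 ℕ.* n) ⟨
    i ^ (4 ℕ.* n)             ≡⟨ ^-* i 4 n ⟩
    (i ^ n) ^ 4               ≡⟨ i^n^4≡1 n ⟩
    1#                        ∎
    where open ≡-Reasoning

  ~-reflexive : ∀ {u v} → u ≡ v → u ~ v
  ~-reflexive {u} refl = 0 , sym (scale-1 u)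

  ~-refl : Reflexive _~_
  ~-refl = ~-reflexive refl

  ~-sym : Symmetric _~_
  ~-sym {u} {.(scale (i ^ n) u)} (n , refl) = 3 ℕ.* n , sym (begin
    scale (i ^ (3 ℕ.* n)) (scale (i ^ n) u)     ≡⟨ scale-scale _ _ u ⟩
    scale (i ^ (3 ℕ.* n) * i ^ n) u             ≡⟨ cong (λ c → scale c u) (i^-inverse n) ⟩
    scale 1# u                                  ≡⟨ scale-1 u ⟩
    u                                           ∎)
    where open ≡-Reasoning

  ~-trans : Transitive _~_
  ~-trans {u} (m , refl) (n , refl) = n ℕ.+ m ,
    trans (scale-scale (i ^ n) (i ^ m) u) (cong (λ c → scale c u) (sym (^-+ i n m)))

  ~-isEquivalence : IsEquivalence _~_
  ~-isEquivalence = record { refl = ~-refl ; sym = ~-sym ; trans = ~-trans }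

  ~-scale : ∀ c {u v} → u ~ v → scale c u ~ scale c v
  ~-scale c {u} (n , refl) = n , scale-comm c (i ^ n) u

  _≟ⱽ_ : (u v : V) → Dec (u ≡ v)
  _≟ⱽ_ = ≡-dec _≟_ _≟_

  _~?_ : Decidable _~_
  u ~? v = map′ (λ (k , e) → toℕ k , e) reduce (any? λ k → v ≟ⱽ scale (i ^ toℕ {4} k) u)
    where
    reduce : u ~ v → ∃ λ k → v ≡ scale (i ^ toℕ {4} k) u
    reduce (n , e) = Fin.fromℕ< (ℕᵈ.m%n<n n 4) , trans e (cong (λ c → scale c u)
      (trans (^-% 4 i^4≡1 n) (cong (i ^_) (sym (Finₚ.toℕ-fromℕ< (ℕᵈ.m%n<n n 4))))))

  NonZero? : ∀ u → Dec (NonZero u)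
  NonZero? (x , y) = ¬? ((x ≟ 0#) ×-dec (y ≟ 0#))

  NonZero-~ : ∀ {u v} → u ~ v → NonZero u → NonZero v
  NonZero-~ {x , y} (n , refl) u≢0 (cx , cy) =
    u≢0 (x*y≡0⇒y≡0 (^≢0 n i≢0) cx , x*y≡0⇒y≡0 (^≢0 n i≢0) cy)

  scale-injective : ∀ {a b} u → NonZero u → scale a u ≡ scale b u → a ≡ b
  scale-injective (x , y) u≢0 eq with x ≟ 0#
  ... | no x≢0 = *-cancelʳ x≢0 (cong proj₁ eq)
  ... | yes x≡0 = *-cancelʳ (λ y≡0 → u≢0 (x≡0 , y≡0)) (cong proj₂ eq)

  vectors : List V
  vectors = cartesianProduct elements elements

  vectors-complete : ∀ u → u ∈ vectors
  vectors-complete (x , y) = ∈-cartesianProduct⁺ (elements-complete x) (elements-complete y)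

  count-vectors : Count _≡_ (λ (_ : V) → ⊤) (order ℕ.* order)
  count-vectors = let (r , _ , r-inj , r-cover) = count-elements in
    count-by {R = _≡_} (*↔× {order} {order}) (λ (j , k) → lookup r j , lookup r k) (λ _ → tt)
      (λ (j , k) (j' , k') e → cong₂ _,_ (r-inj j j' (cong proj₁ e)) (r-inj k k' (cong proj₂ e)))
      (λ (x , y) _ → let (j , e) = r-cover x tt ; (k , e') = r-cover y tt in
        (j , k) , cong₂ _,_ e e')

  -- A class of nonzero vectors has four members.
  count-quotient : ∀ {Q : V → Set} {M} → (∀ u → Q u → NonZero u) → (∀ u → Dec (Q u)) →
                   (∀ u v → u ~ v → Q u → Q v) → Count _≡_ Q M →
                   ∃ λ n → M ≡ n ℕ.* 4 × Count _~_ Q n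
  count-quotient {Q} {M} Q⇒≢0 Q? resp cQ = proj₁ classes ,
    trans (sym (ℕₚ.*-identityʳ M))
      -- Vectors on the left are taken up to equality, those on the right up to ~: a vector lies in
      -- one class, and a class contains the four multiples of a vector by powers of i.
      (double-count {I = λ u v → Q u × u ~ v} isEquivalence ~-isEquivalence
        (λ u v (q , e) → q , resp u v e q) (λ { _ _ _ refl p → p })
        (λ u v v' e (q , e') → q , ~-trans e' e)
        cQ (λ u q → u ∷ [] , (λ { 0F → q , ~-refl }) , (λ { 0F 0F _ → refl }) ,
                    λ v (_ , e) → 0F , ~-sym e)
        (proj₂ classes) four) ,
    proj₂ classes
    where
    classes = count-exists ~-isEquivalence _~?_ Q? resp vectors
      (λ u _ → Any.map ~-reflexive (vectors-complete u))
    four : ∀ v → Q v → Count _≡_ (λ u → Q u × u ~ v) 4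
    four v q = count-by {R = _≡_} (↔-id _) (λ k → scale (i ^ toℕ k) v)
      (λ k → resp v _ (toℕ k , refl) q , ~-sym (toℕ k , refl))
      (λ j k e → i^-injective j k (scale-injective v (Q⇒≢0 v q) e))
      (λ u (_ , e) → let (n , e') = ~-sym e in Fin.fromℕ< (ℕᵈ.m%n<n n 4) , trans e'
        (cong (λ c → scale c v) (trans (^-% 4 i^4≡1 n)
          (cong (i ^_) (sym (Finₚ.toℕ-fromℕ< (ℕᵈ.m%n<n n 4)))))))

  count-points : ∃ λ v → order ℕ.* order ≡ suc (v ℕ.* 4) × Count _~_ NonZero v
  count-points = let (v , M≡ , c) = count-quotient (λ _ q → q) NonZero? (λ _ _ → NonZero-~) cM in
    v , trans (count-unique isEquivalence count-vectors all) (cong suc M≡) , c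
    where
    nonzeros = count-exists {Q = NonZero} isEquivalence _≟ⱽ_ NonZero? (λ { _ _ refl q → q })
      vectors (λ u _ → vectors-complete u)
    cM = proj₂ nonzeros
    split : ∀ u → ⊤ → u ≡ (0# , 0#) ⊎ NonZero u
    split (x , y) _ with x ≟ 0# | y ≟ 0#
    ... | yes refl | yes refl = inj₁ refl
    ... | no x≢0 | _ = inj₂ (x≢0 ∘ proj₁)
    ... | _ | no y≢0 = inj₂ (y≢0 ∘ proj₂)
    all = count-cons isEquivalence (0# , 0#) tt (λ _ u≢0 → tt , λ { refl → u≢0 (refl , refl) })
      split cM

  -- The nonzero multiples of `e₁`. Modulo powers of i there are (q - 1)/4 of them, and they label
  -- both families of orbits of pairs.
  Axis : V → Set
  Axis u = NonZero u × proj₂ u ≡ 0#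

  count-axis : ∃ λ N → order ≡ suc (N ℕ.* 4) × Count _~_ Axis N
  count-axis = let (N , n≡ , c) = count-quotient (λ _ → proj₁)
                     (λ u → NonZero? u ×-dec (proj₂ u ≟ 0#)) resp line in
    N , trans (proj₁ (proj₂ count-nonzero)) (cong suc n≡) , c
    where
    resp : ∀ u v → u ~ v → Axis u → Axis v
    resp (x , _) _ (n , refl) (u≢0 , refl) =
      NonZero-~ {x , 0#} (n , refl) u≢0 , zeroʳ _
    line : Count _≡_ Axis (proj₁ count-nonzero)
    line = count-map {R = _≡_} isEquivalence (_, 0#) (λ x x≢0 → x≢0 ∘ proj₁ , refl)
      (λ { _ _ refl → refl }) (λ { _ _ _ _ refl → refl })
      (λ { (x , _) (u≢0 , refl) → x , (λ x≡0 → u≢0 (x≡0 , refl)) , refl })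
      (proj₂ (proj₂ count-nonzero))

  -- The action of SL₂

  _∙_ : Mat → Mat → Mat
  mat a b c d ∙ mat a' b' c' d' =
    mat (a * a' + b * c') (a * b' + b * d') (c * a' + d * c') (c * b' + d * d')

  abstract
    det-∙ : ∀ g h → det g ≡ 1# → det h ≡ 1# → det (g ∙ h) ≡ 1#
    det-∙ (mat a b c d) (mat a' b' c' d') g₁ h₁ = trans (solve 8 (λ a b c d a' b' c' d' →
        (a :* a' :+ b :* c') :* (c :* b' :+ d :* d') :- (a :* b' :+ b :* d') :* (c :* a' :+ d :* c')
        := (a :* d :- b :* c) :* (a' :* d' :- b' :* c')) refl a b c d a' b' c' d')
      (trans (cong₂ _*_ g₁ h₁) (*-identityˡ 1#))

    det-inv : ∀ a b c d → det (mat a b c d) ≡ 1# → det (mat d (- b) (- c) a) ≡ 1#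
    det-inv a b c d g₁ = trans
      (solve 4 (λ a b c d → d :* a :- (:- b) :* (:- c) := a :* d :- b :* c) refl a b c d) g₁

    det-shear : ∀ t → det (mat 1# (- t) 0# 1#) ≡ 1#
    det-shear = solve 1 (λ t → :1 :* :1 :- (:- t) :* :0 := :1) refl

    det-ε : det (mat 1# 0# 0# 1#) ≡ 1#
    det-ε = solve 0 (:1 :* :1 :- :0 :* :0 := :1) refl

  infixl 7 _·_
  _·_ : SL → SL → SL
  (g , g₁) · (h , h₁) = g ∙ h , det-∙ g h g₁ h₁

  ε : SL
  ε = mat 1# 0# 0# 1# , det-ε

  inv : SL → SL
  inv (mat a b c d , g₁) = mat d (- b) (- c) a , det-inv a b c d g₁

  act-· : ∀ g h u → act (g · h) u ≡ act g (act h u)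
  act-· (mat a b c d , _) (mat a' b' c' d' , _) (x , y) =
    cong₂ _,_ (entry a b) (entry c d)
    where
    entry : ∀ a b → (a * a' + b * c') * x + (a * b' + b * d') * y ≡
                    a * (a' * x + b' * y) + b * (c' * x + d' * y)
    entry a b = solve 8 (λ a b a' b' c' d' x y →
      (a :* a' :+ b :* c') :* x :+ (a :* b' :+ b :* d') :* y
      := a :* (a' :* x :+ b' :* y) :+ b :* (c' :* x :+ d' :* y)) refl a b a' b' c' d' x y

  act-ε : ∀ u → act ε u ≡ u
  act-ε (x , y) = cong₂ _,_
    (solve 2 (λ x y → :1 :* x :+ :0 :* y := x) refl x y)
    (solve 2 (λ x y → :0 :* x :+ :1 :* y := y) refl x y)

  act-inv : ∀ g u → act (inv g) (act g u) ≡ u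
  act-inv (mat a b c d , g₁) (x , y) = cong₂ _,_
    (trans (solve 6 (λ a b c d x y →
      d :* (a :* x :+ b :* y) :+ (:- b) :* (c :* x :+ d :* y) := (a :* d :- b :* c) :* x)
      refl a b c d x y) (trans (cong (_* x) g₁) (*-identityˡ x)))
    (trans (solve 6 (λ a b c d x y →
      (:- c) :* (a :* x :+ b :* y) :+ a :* (c :* x :+ d :* y) := (a :* d :- b :* c) :* y)
      refl a b c d x y) (trans (cong (_* y) g₁) (*-identityˡ y)))

  act-inv′ : ∀ g u → act g (act (inv g) u) ≡ u
  act-inv′ (mat a b c d , g₁) (x , y) = cong₂ _,_
    (trans (solve 6 (λ a b c d x y →
      a :* (d :* x :+ (:- b) :* y) :+ b :* ((:- c) :* x :+ a :* y) := (a :* d :- b :* c) :* x)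
      refl a b c d x y) (trans (cong (_* x) g₁) (*-identityˡ x)))
    (trans (solve 6 (λ a b c d x y →
      c :* (d :* x :+ (:- b) :* y) :+ d :* ((:- c) :* x :+ a :* y) := (a :* d :- b :* c) :* y)
      refl a b c d x y) (trans (cong (_* y) g₁) (*-identityˡ y)))

  act-scale : ∀ g c u → act g (scale c u) ≡ scale c (act g u)
  act-scale (mat a b c d , _) s (x , y) = cong₂ _,_ (entry a b) (entry c d)
    where
    entry : ∀ a b → a * (s * x) + b * (s * y) ≡ s * (a * x + b * y)
    entry a b = solve 5 (λ a b s x y →
      a :* (s :* x) :+ b :* (s :* y) := s :* (a :* x :+ b :* y)) refl a b s x y

  act-~ : ∀ g {u v} → u ~ v → act g u ~ act g v
  act-~ g {u} (n , refl) = n , act-scale g (i ^ n) u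

  act-~⁻ : ∀ g {u v} → act g u ~ act g v → u ~ v
  act-~⁻ g {u} {v} e = subst₂ _~_ (act-inv g u) (act-inv g v) (act-~ (inv g) e)

  act-inv-~ : ∀ g {u v} → act g u ~ v → act (inv g) v ~ u
  act-inv-~ g {u} e = subst (_ ~_) (act-inv g u) (act-~ (inv g) (~-sym e))

  act-·-~ : ∀ g h {u v w} → act h u ~ v → act g v ~ w → act (g · h) u ~ w
  act-·-~ g h {u} e e' = ~-trans (~-trans (~-reflexive (act-· g h u)) (act-~ g e)) e'

  act-NonZero : ∀ g {u} → NonZero u → NonZero (act g u)
  act-NonZero g@(mat a b c d , _) {u} u≢0 (p , q) = u≢0
    (subst (λ w → proj₁ w ≡ 0# × proj₂ w ≡ 0#) (act-inv g u) (zero-entry d (- b) , zero-entry (- c) a))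
    where
    zero-entry : ∀ s t → s * proj₁ (act g u) + t * proj₂ (act g u) ≡ 0#
    zero-entry s t = trans (cong₂ (λ x y → s * x + t * y) p q)
      (solve 2 (λ s t → s :* :0 :+ t :* :0 := :0) refl s t)

  toSL : V × V → SL
  toSL ((a , b) , (c , d)) with det (mat a b c d) ≟ 1#
  ... | yes g₁ = mat a b c d , g₁
  -- A harmless default, since the list `transformations` only has to be exhaustive.
  ... | no _ = ε

  act-toSL : ∀ a b c d g₁ u → act (toSL ((a , b) , (c , d))) u ≡ act (mat a b c d , g₁) u
  act-toSL a b c d g₁ u with det (mat a b c d) ≟ 1#
  ... | yes _ = refl
  ... | no ¬g₁ = ⊥-elim (¬g₁ g₁)

  transformations : List SL
  transformations = map toSL (cartesianProduct vectors vectors)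

  -- An element of `SL` includes a proof that its determinant is 1, so agreement is stated through
  -- the action.
  transformations-complete : ∀ g → Any (λ h → ∀ u → act h u ≡ act g u) transformations
  transformations-complete (mat a b c d , g₁) = lose
    (∈-map⁺ toSL (∈-cartesianProduct⁺ (vectors-complete (a , b)) (vectors-complete (c , d))))
    (act-toSL a b c d g₁)

  -- Orbits of pairs

  Pair : Set
  Pair = V × V

  Orbit : Pair → Pair → Set
  Orbit (u , v) (u' , v') = SameOrbit u v u' v'

  Orbit-isEquivalence : IsEquivalence Orbit
  Orbit-isEquivalence = record
    { refl = ε , ~-reflexive (act-ε _) , ~-reflexive (act-ε _)
    ; sym = λ (g , e , e') → inv g , act-inv-~ g e , act-inv-~ g e'
    ; trans = λ (g , e , e') (h , f , f') → h · g , act-·-~ h g e f , act-·-~ h g e' f'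
    }

  open IsEquivalence Orbit-isEquivalence using ()
    renaming (refl to Orbit-refl; sym to Orbit-sym; trans to Orbit-trans)

  Orbit? : Decidable Orbit
  Orbit? (u , v) (u' , v') = map′ found search
    (Any.any? (λ g → (act g u ~? u') ×-dec (act g v ~? v')) transformations)
    where
    found : Any (λ g → act g u ~ u' × act g v ~ v') transformations → SameOrbit u v u' v'
    found a = Any.satisfied a
    search : SameOrbit u v u' v' → Any (λ g → act g u ~ u' × act g v ~ v') transformations
    search (g , e , e') = Any.map
      (λ same → subst (_~ u') (sym (same u)) e , subst (_~ v') (sym (same v)) e')
      (transformations-complete g)

  det₂ : V → V → Carrier
  det₂ (x , y) (x' , y') = (x * y') - (y * x')

  det₂-act : ∀ g u v → det₂ (act g u) (act g v) ≡ det₂ u v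
  det₂-act (mat a b c d , g₁) (x , y) (x' , y') = trans
    (solve 8 (λ a b c d x y x' y' →
      (a :* x :+ b :* y) :* (c :* x' :+ d :* y') :- (c :* x :+ d :* y) :* (a :* x' :+ b :* y')
      := (a :* d :- b :* c) :* (x :* y' :- y :* x')) refl a b c d x y x' y')
    (trans (cong (_* _) g₁) (*-identityˡ _))

  det₂-scale : ∀ s t u v → det₂ (scale s u) (scale t v) ≡ s * t * det₂ u v
  det₂-scale s t (x , y) (x' , y') = solve 6 (λ s t x y x' y' →
    (s :* x) :* (t :* y') :- (s :* y) :* (t :* x') := s :* t :* (x :* y' :- y :* x'))
    refl s t x y x' y'

  -- A unimodular g preserves `det₂`, so only the choice of representatives changes it, by powers of
  -- i.
  orbit-det₂ : ∀ {u v u' v'} → SameOrbit u v u' v' → ∃ λ n → det₂ u' v' ≡ i ^ n * det₂ u v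
  orbit-det₂ {u} {v} (g , (m , refl) , (n , refl)) = m ℕ.+ n , (begin
    det₂ (scale (i ^ m) (act g u)) (scale (i ^ n) (act g v))  ≡⟨ det₂-scale _ _ (act g u) (act g v) ⟩
    i ^ m * i ^ n * det₂ (act g u) (act g v)                  ≡⟨ cong₂ _*_ (sym (^-+ i m n)) (det₂-act g u v) ⟩
    i ^ (m ℕ.+ n) * det₂ u v                                  ∎)
    where open ≡-Reasoning

  abstract
    -- The second row (- y, x) annihilates (x, y); the first row, built from an inverse of x or, if
    -- x = 0, of y, makes both the determinant and the first coordinate of the image 1.
    transitive : ∀ u → NonZero u → ∃ λ g → act g u ≡ e₁
    transitive (x , y) u≢0 with x ≟ 0#
    ... | no x≢0 = let (z , xz≡1) = inverse x x≢0 in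
      (mat z 0# (- y) x ,
        trans (solve 3 (λ x y z → z :* x :- :0 :* (:- y) := x :* z) refl x y z) xz≡1) ,
      cong₂ _,_ (trans (solve 3 (λ x y z → z :* x :+ :0 :* y := x :* z) refl x y z) xz≡1)
        (solve 2 (λ x y → (:- y) :* x :+ x :* y := :0) refl x y)
    ... | yes refl = let (z , yz≡1) = inverse y (λ y≡0 → u≢0 (refl , y≡0)) in
      (mat 0# z (- y) 0# ,
        trans (solve 2 (λ y z → :0 :* :0 :- z :* (:- y) := y :* z) refl y z) yz≡1) ,
      cong₂ _,_ (trans (solve 2 (λ y z → :0 :* :0 :+ z :* y := y :* z) refl y z) yz≡1)
        (solve 1 (λ y → (:- y) :* :0 :+ :0 :* y := :0) refl y)

  -- The sign makes `shear (τ k)` move the neighbour (`τ k`, 1) of `e₁` onto `e₂`.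
  shear : Carrier → SL
  shear t = mat 1# (- t) 0# 1# , det-shear t

  act-shear : ∀ t x y → act (shear t) (x , y) ≡ (x - (t * y) , y)
  act-shear t x y = cong₂ _,_
    (solve 3 (λ t x y → :1 :* x :+ (:- t) :* y := x :- t :* y) refl t x y)
    (solve 2 (λ x y → :0 :* x :+ :1 :* y := y) refl x y)

  act-shear-e₁ : ∀ t → act (shear t) e₁ ≡ e₁
  act-shear-e₁ t = trans (act-shear t 1# 0#)
    (cong (_, 0#) (solve 1 (λ t → :1 :- t :* :0 := :1) refl t))

  -- The stabiliser of the block T

  T : Fin 6 → V
  T = Tvec

  ≈B-refl : Reflexive _≈B_
  ≈B-refl {g} = (λ j → j , ~-refl {act g (T j)}) , (λ j → j , ~-refl {act g (T j)})

  ≈B-sym : Symmetric _≈B_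
  ≈B-sym (to , from) = from , to

  ≈B-trans : Transitive _≈B_
  ≈B-trans {g} {h} {k} (to , from) (to' , from') =
    compose {g} {h} {k} to to' , compose {k} {h} {g} from' from
    where
    compose : ∀ {g h k} → (∀ j → ∃ λ j' → act g (T j) ~ act h (T j')) →
              (∀ j → ∃ λ j' → act h (T j) ~ act k (T j')) →
              ∀ j → ∃ λ j' → act g (T j) ~ act k (T j')
    compose p q j = let (j' , e) = p j ; (j'' , e') = q j' in j'' , ~-trans e e'

  ≈B-isEquivalence : IsEquivalence _≈B_
  ≈B-isEquivalence = record { refl = λ {g} → ≈B-refl {g} ; sym = λ {g} {h} → ≈B-sym {g} {h}
                            ; trans = λ {g} {h} {k} → ≈B-trans {g} {h} {k} }

  ≈B-pointwise : ∀ g h → (∀ u → act g u ≡ act h u) → g ≈B h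
  ≈B-pointwise g h same = (λ j → j , ~-reflexive (same (T j))) ,
                          (λ j → j , ~-reflexive (sym (same (T j))))

  _≈B?_ : Decidable _≈B_
  g ≈B? h = all? (λ j → any? λ j' → act g (T j) ~? act h (T j')) ×-dec
            all? (λ j → any? λ j' → act h (T j) ~? act g (T j'))

  ∈B-≈B : ∀ {u} g h → g ≈B h → u ∈B g → u ∈B h
  ∈B-≈B g h (to , _) (j , e) = let (j' , e') = to j in j' , ~-trans e e'

  ∈B-~ : ∀ {u v} g → u ~ v → u ∈B g → v ∈B g
  ∈B-~ g e (j , e') = j , ~-trans (~-sym e) e'

  ∈B-translate : ∀ k g {u} → u ∈B g → act k u ∈B (k · g)
  ∈B-translate k g (j , e) = j , ~-trans (act-~ k e) (~-reflexive (sym (act-· k g (T j))))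

  ≈B-translate : ∀ k g h → g ≈B h → (k · g) ≈B (k · h)
  ≈B-translate k g h (to , from) = shift g h to , shift h g from
    where
    shift : ∀ g h → (∀ j → ∃ λ j' → act g (T j) ~ act h (T j')) →
            ∀ j → ∃ λ j' → act (k · g) (T j) ~ act (k · h) (T j')
    shift g h p j = let (j' , e) = p j in
      j' , subst₂ _~_ (sym (act-· k g _)) (sym (act-· k h _)) (act-~ k e)

  ·-cancel-inv : ∀ k g → g ≈B (k · (inv k · g))
  ·-cancel-inv k g = ≈B-pointwise g (k · (inv k · g)) λ u → sym
    (trans (act-· k (inv k · g) u) (trans (cong (act k) (act-· (inv k) g u)) (act-inv′ k (act g u))))

  ≈B-translate⁻ : ∀ k g h → (k · g) ≈B (k · h) → g ≈B h
  ≈B-translate⁻ k g h (to , from) = shift g h to , shift h g from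
    where
    shift : ∀ g h → (∀ j → ∃ λ j' → act (k · g) (T j) ~ act (k · h) (T j')) →
            ∀ j → ∃ λ j' → act g (T j) ~ act h (T j')
    shift g h p j = let (j' , e) = p j in
      j' , act-~⁻ k (subst₂ _~_ (act-· k g _) (act-· k h _) e)

  -- The relation `h ≈B ε` with the action of `ε` already evaluated.
  Stab : SL → Set
  Stab h = (∀ j → ∃ λ j' → act h (T j) ~ T j') × (∀ j → ∃ λ j' → T j ~ act h (T j'))

  Stab-· : ∀ g h → Stab g → Stab h → Stab (g · h)
  Stab-· g h (to , from) (to' , from') =
    (λ j → let (j' , e) = to' j ; (j'' , e') = to j' in j'' , act-·-~ g h e e') ,
    (λ j → let (j' , e) = from j ; (j'' , e') = from' j' in
      j'' , ~-sym (act-·-~ g h (~-sym e') (~-sym e)))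

  ≈B-Stab : ∀ g h → Stab h → (g · h) ≈B g
  ≈B-Stab g h (to , from) =
    (λ j → let (j' , e) = to j in j' , act-·-~ g h e ~-refl) ,
    (λ j → let (j' , e) = from j in j' , ~-sym (act-·-~ g h (~-sym e) ~-refl))

  Stab-by-permutation : ∀ h (π π⁻ : Fin 6 → Fin 6) (n : Fin 6 → ℕ) → (∀ j → π (π⁻ j) ≡ j) →
                        (∀ j → T (π j) ≡ scale (i ^ n j) (act h (T j))) → Stab h
  Stab-by-permutation h π π⁻ n ππ⁻ image =
    (λ j → π j , n j , image j) ,
    (λ j → π⁻ j , ~-sym (n (π⁻ j) , trans (cong T (sym (ππ⁻ j))) (image (π⁻ j))))

  -- Closed expressions over the Gaussian integers: `Tᵖ`, `i^ᵖ` and `imageᵖ` copy `T`, the powers of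
  -- i and the scaled action term by term, so that every coordinate of a vertex image is settled by
  -- normalisation.
  Vᵖ : Set
  Vᵖ = Polynomial 0 × Polynomial 0

  Tᵖ : Fin 6 → Vᵖ
  Tᵖ 0F = :1 , :0
  Tᵖ 1F = :0 , :1
  Tᵖ 2F = :1 , :1
  Tᵖ 3F = :1 :+ :i , :1
  Tᵖ 4F = :i , :1
  Tᵖ 5F = :1 , :1 :- :i

  i^ᵖ : ℕ → Polynomial 0
  i^ᵖ zero = :1
  i^ᵖ (suc n) = :i :* i^ᵖ n

  imageᵖ : (a b c d : Polynomial 0) → ℕ → Vᵖ → Vᵖ
  imageᵖ a b c d n (x , y) = i^ᵖ n :* (a :* x :+ b :* y) , i^ᵖ n :* (c :* x :+ d :* y)

  abstract
    det-σ : det (mat 0# (- 1#) 1# (- 1#)) ≡ 1#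
    det-σ = solve 0 (:0 :* (:- :1) :- (:- :1) :* :1 := :1) refl

    det-ρ : det (mat i (1# - i) 0# (- i)) ≡ 1#
    det-ρ = solve 0 (:i :* (:- :i) :- (:1 :- :i) :* :0 := :1) refl

  -- The rotation e₁ → e₂ → e₁ + e₂ of order 3 about a face of the octahedron.
  σ : SL
  σ = mat 0# (- 1#) 1# (- 1#) , det-σ

  σ-Stab : Stab σ
  σ-Stab = Stab-by-permutation σ π (lookup (2F ∷ 0F ∷ 1F ∷ 5F ∷ 3F ∷ 4F ∷ [])) n
    (λ { 0F → refl ; 1F → refl ; 2F → refl ; 3F → refl ; 4F → refl ; 5F → refl })
    λ { 0F → cong₂ _,_ (prove [] (l₁ 0F) (r₁ 0F) refl) (prove [] (l₂ 0F) (r₂ 0F) refl)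
      ; 1F → cong₂ _,_ (prove [] (l₁ 1F) (r₁ 1F) refl) (prove [] (l₂ 1F) (r₂ 1F) refl)
      ; 2F → cong₂ _,_ (prove [] (l₁ 2F) (r₁ 2F) refl) (prove [] (l₂ 2F) (r₂ 2F) refl)
      ; 3F → cong₂ _,_ (prove [] (l₁ 3F) (r₁ 3F) refl) (prove [] (l₂ 3F) (r₂ 3F) refl)
      ; 4F → cong₂ _,_ (prove [] (l₁ 4F) (r₁ 4F) refl) (prove [] (l₂ 4F) (r₂ 4F) refl)
      ; 5F → cong₂ _,_ (prove [] (l₁ 5F) (r₁ 5F) refl) (prove [] (l₂ 5F) (r₂ 5F) refl) }
    where
    -- `π` lists the images of the six vertices, and `n` the exponents of i that turn these images
    -- into the chosen representatives `T (π j)`.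
    π = lookup (1F ∷ 2F ∷ 0F ∷ 4F ∷ 5F ∷ 3F ∷ [])
    n = lookup (0 ∷ 2 ∷ 2 ∷ 3 ∷ 2 ∷ 3 ∷ [])
    l₁ l₂ r₁ r₂ : Fin 6 → Polynomial 0
    l₁ j = proj₁ (Tᵖ (π j))
    l₂ j = proj₂ (Tᵖ (π j))
    r₁ j = proj₁ (imageᵖ :0 (:- :1) :1 (:- :1) (n j) (Tᵖ j))
    r₂ j = proj₂ (imageᵖ :0 (:- :1) :1 (:- :1) (n j) (Tᵖ j))

  -- The half turn about the axis through e₁ and its antipode T 5F, which it multiplies by i and - i.
  ρ : SL
  ρ = mat i (1# - i) 0# (- i) , det-ρ

  ρ-Stab : Stab ρ
  -- On vertices ρ exchanges 1 with 3 and 2 with 4, the two antipodal pairs on the equator, so `π`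
  -- is its own inverse.
  ρ-Stab = Stab-by-permutation ρ π π n
    (λ { 0F → refl ; 1F → refl ; 2F → refl ; 3F → refl ; 4F → refl ; 5F → refl })
    λ { 0F → cong₂ _,_ (prove [] (l₁ 0F) (r₁ 0F) refl) (prove [] (l₂ 0F) (r₂ 0F) refl)
      ; 1F → cong₂ _,_ (prove [] (l₁ 1F) (r₁ 1F) refl) (prove [] (l₂ 1F) (r₂ 1F) refl)
      ; 2F → cong₂ _,_ (prove [] (l₁ 2F) (r₁ 2F) refl) (prove [] (l₂ 2F) (r₂ 2F) refl)
      ; 3F → cong₂ _,_ (prove [] (l₁ 3F) (r₁ 3F) refl) (prove [] (l₂ 3F) (r₂ 3F) refl)
      ; 4F → cong₂ _,_ (prove [] (l₁ 4F) (r₁ 4F) refl) (prove [] (l₂ 4F) (r₂ 4F) refl)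
      ; 5F → cong₂ _,_ (prove [] (l₁ 5F) (r₁ 5F) refl) (prove [] (l₂ 5F) (r₂ 5F) refl) }
    where
    π = lookup (0F ∷ 3F ∷ 4F ∷ 1F ∷ 2F ∷ 5F ∷ [])
    n = lookup (3 ∷ 1 ∷ 1 ∷ 1 ∷ 1 ∷ 1 ∷ [])
    l₁ l₂ r₁ r₂ : Fin 6 → Polynomial 0
    l₁ j = proj₁ (Tᵖ (π j))
    l₂ j = proj₂ (Tᵖ (π j))
    r₁ j = proj₁ (imageᵖ :i (:1 :- :i) :0 (:- :i) (n j) (Tᵖ j))
    r₂ j = proj₂ (imageᵖ :i (:1 :- :i) :0 (:- :i) (n j) (Tᵖ j))

  ε-Stab : Stab ε
  ε-Stab = (λ j → j , ~-reflexive (act-ε (T j))) , (λ j → j , ~-reflexive (sym (act-ε (T j))))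

  Reached : Fin 6 → Set
  Reached j = ∃ λ h → Stab h × act h e₁ ~ T j

  -- σ permutes the vertices in the cycles 0, 1, 2 and 3, 4, 5, and ρ links the cycles by taking 1
  -- to 3.
  Stab-transitive : ∀ j → Reached j
  Stab-transitive = λ where
      0F → r₀
      1F → r₁
      2F → by-σ 1F r₁
      3F → r₃
      4F → r₄
      5F → by-σ 4F r₄
    where
    by-σ : ∀ j → Reached j → Reached (proj₁ (proj₁ σ-Stab j))
    by-σ j (h , s , e) = σ · h , Stab-· σ h σ-Stab s , act-·-~ σ h e (proj₂ (proj₁ σ-Stab j))
    r₀ : Reached 0F
    r₀ = ε , ε-Stab , ~-reflexive (act-ε e₁)
    r₁ : Reached 1F
    r₁ = by-σ 0F r₀
    r₃ : Reached 3F
    r₃ = let (h , s , e) = r₁ in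
      ρ · h , Stab-· ρ h ρ-Stab s , act-·-~ ρ h e (proj₂ (proj₁ ρ-Stab 1F))
    r₄ : Reached 4F
    r₄ = by-σ 3F r₃

  ρ-power : ∀ n → ∃ λ h → Stab h × act h e₁ ≡ scale (i ^ n) e₁
  ρ-power zero = ε , ε-Stab , trans (act-ε e₁) (sym (scale-1 e₁))
  ρ-power (suc n) = let (h , s , e) = ρ-power n in ρ · h , Stab-· ρ h ρ-Stab s , (begin
    act (ρ · h) e₁                  ≡⟨ act-· ρ h e₁ ⟩
    act ρ (act h e₁)                ≡⟨ cong (act ρ) e ⟩
    act ρ (scale (i ^ n) e₁)        ≡⟨ act-scale ρ (i ^ n) e₁ ⟩
    scale (i ^ n) (act ρ e₁)        ≡⟨ cong (scale (i ^ n)) ρe₁ ⟩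
    scale (i ^ n) (scale i e₁)      ≡⟨ scale-comm (i ^ n) i e₁ ⟩
    scale i (scale (i ^ n) e₁)      ≡⟨ scale-scale i (i ^ n) e₁ ⟩
    scale (i ^ suc n) e₁            ∎)
    where
    open ≡-Reasoning
    ρe₁ : act ρ e₁ ≡ scale i e₁
    ρe₁ = cong₂ _,_ (solve 0 (:i :* :1 :+ (:1 :- :i) :* :0 := :i :* :1) refl)
                    (solve 0 (:0 :* :1 :+ (:- :i) :* :0 := :i :* :0) refl)

  fix-e₁⇒shear : ∀ g → act g e₁ ≡ e₁ → ∃ λ t → ∀ u → act g u ≡ act (shear t) u
  fix-e₁⇒shear (mat a b c d , g₁) eq = - b , λ (x , y) → cong₂ _,_
    (cong₂ (λ s t → s * x + t * y) a≡1 (solve 1 (λ b → b := :- (:- b)) refl b))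
    (cong₂ (λ s t → s * x + t * y) c≡0 d≡1)
    where
    column : ∀ s t → s * 1# + t * 0# ≡ s
    column s t = solve 2 (λ s t → s :* :1 :+ t :* :0 := s) refl s t
    a≡1 : a ≡ 1#
    a≡1 = trans (sym (column a b)) (cong proj₁ eq)
    c≡0 : c ≡ 0#
    c≡0 = trans (sym (column c d)) (cong proj₂ eq)
    d≡1 : d ≡ 1#
    d≡1 = trans (solve 2 (λ b d → d := :1 :* d :- b :* :0) refl b d)
      (trans (sym (cong₂ (λ s t → (s * d) - (b * t)) a≡1 c≡0)) g₁)

  fix-[e₁]⇒shear : ∀ g → act g e₁ ~ e₁ → ∃ λ t → g ≈B shear t
  fix-[e₁]⇒shear g (n , e₁≡) = t ,
    ≈B-trans {g} {g · h} {shear t} (≈B-sym {g · h} {g} (≈B-Stab g h h-Stab))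
      (≈B-pointwise (g · h) (shear t) same)
    where
    open ≡-Reasoning
    h = proj₁ (ρ-power n)
    h-Stab = proj₁ (proj₂ (ρ-power n))
    fixed : act (g · h) e₁ ≡ e₁
    fixed = begin
      act (g · h) e₁             ≡⟨ act-· g h e₁ ⟩
      act g (act h e₁)           ≡⟨ cong (act g) (proj₂ (proj₂ (ρ-power n))) ⟩
      act g (scale (i ^ n) e₁)   ≡⟨ act-scale g (i ^ n) e₁ ⟩
      scale (i ^ n) (act g e₁)   ≡⟨ e₁≡ ⟨
      e₁                         ∎
    t = proj₁ (fix-e₁⇒shear (g · h) fixed)
    same = proj₂ (fix-e₁⇒shear (g · h) fixed)

  -- Composing g with an element of the stabiliser of T leaves the block alone and lets any chosen
  -- vertex play the role of `e₁`.
  ∈B⇒vertex : ∀ {u} g → u ∈B g → ∃ λ h → h ≈B g × act h e₁ ~ u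
  ∈B⇒vertex g (j , e) = let (h , s , e') = Stab-transitive j in
    g · h , ≈B-Stab g h s , act-·-~ g h e' (~-sym e)

  e₁∈B⇒shear : ∀ g → e₁ ∈B g → ∃ λ t → g ≈B shear t
  e₁∈B⇒shear g e₁∈g = let (h , h≈g , e) = ∈B⇒vertex g e₁∈g ; (t , h≈) = fix-[e₁]⇒shear h e in
    t , ≈B-trans {g} {h} {shear t} (≈B-sym {h} {g} h≈g) h≈

  -- First coordinates of the four neighbours of `e₁`, in cyclic order around the equator; their
  -- second coordinate is 1.
  τ : Fin 4 → Carrier
  τ 0F = 0#
  τ 1F = 1#
  τ 2F = 1# + i
  τ 3F = i

  middle : Fin 4 → Fin 6
  middle k = suc (inject₁ k)

  T-middle : ∀ k → T (middle k) ≡ (τ k , 1#)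
  T-middle 0F = refl
  T-middle 1F = refl
  T-middle 2F = refl
  T-middle 3F = refl

  -- The three cases correspond to the second coordinates 0, 1 and 1 - i of the vertices.
  data Position : Fin 6 → Set where
    pole : Position 0F
    equator : ∀ k → Position (middle k)
    antipode : Position 5F

  position : ∀ j → Position j
  position 0F = pole
  position 1F = equator 0F
  position 2F = equator 1F
  position 3F = equator 2F
  position 4F = equator 3F
  position 5F = antipode

  1-i : Carrier
  1-i = 1# - i

  i≢1 : i ≢ 1#
  i≢1 i≡1 with i^-injective 1F 0F (trans (*-identityʳ i) i≡1)
  ... | ()

  x-y≡0⇒x≡y : ∀ x y → x - y ≡ 0# → x ≡ y
  x-y≡0⇒x≡y x y eq = trans (solve 2 (λ x y → x := (x :- y) :+ y) refl x y)
    (trans (cong (_+ y) eq) (+-identityˡ y))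

  1-i≢0 : 1-i ≢ 0#
  1-i≢0 eq = i≢1 (sym (x-y≡0⇒x≡y 1# i eq))

  1+i≢0 : 1# + i ≢ 0#
  1+i≢0 eq = i≢0 (x*y≡0⇒y≡0 1-i≢0 (begin
    1-i * i      ≡⟨ solve 0 ((:1 :- :i) :* :i := :1 :+ :i) refl ⟩
    1# + i       ≡⟨ eq ⟩
    0#           ∎))
    where open ≡-Reasoning

  τ-injective : ∀ j k → τ j ≡ τ k → j ≡ k
  τ-injective 0F 0F _ = refl
  τ-injective 0F 1F eq = ⊥-elim (0≢1 eq)
  τ-injective 0F 2F eq = ⊥-elim (1+i≢0 (sym eq))
  τ-injective 0F 3F eq = ⊥-elim (i≢0 (sym eq))
  τ-injective 1F 1F _ = refl
  τ-injective 1F 2F eq = ⊥-elim (i≢0 (begin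
    i                ≡⟨ solve 0 (:i := (:1 :+ :i) :- :1) refl ⟩
    (1# + i) - 1#    ≡⟨ cong (_- 1#) eq ⟨
    1# - 1#          ≡⟨ -‿inverseʳ 1# ⟩
    0#               ∎))
    where open ≡-Reasoning
  τ-injective 1F 3F eq = ⊥-elim (i≢1 (sym eq))
  τ-injective 2F 2F _ = refl
  τ-injective 2F 3F eq = ⊥-elim (1≢0 (begin
    1#               ≡⟨ solve 0 (:1 := (:1 :+ :i) :- :i) refl ⟩
    (1# + i) - i     ≡⟨ cong (_- i) eq ⟩
    i - i            ≡⟨ -‿inverseʳ i ⟩
    0#               ∎))
    where open ≡-Reasoning
  τ-injective 3F 3F _ = refl
  τ-injective 1F 0F eq = sym (τ-injective 0F 1F (sym eq))
  τ-injective 2F 0F eq = sym (τ-injective 0F 2F (sym eq))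
  τ-injective 3F 0F eq = sym (τ-injective 0F 3F (sym eq))
  τ-injective 2F 1F eq = sym (τ-injective 1F 2F (sym eq))
  τ-injective 3F 1F eq = sym (τ-injective 1F 3F (sym eq))
  τ-injective 3F 2F eq = sym (τ-injective 2F 3F (sym eq))

  -- Pairs with det₂ = 0 are classified by their ratio, the others by det₂, both modulo powers of i.

  NonZeroPair : Pair → Set
  NonZeroPair (u , v) = NonZero u × NonZero v

  NonZeroPair? : ∀ p → Dec (NonZeroPair p)
  NonZeroPair? (u , v) = NonZero? u ×-dec NonZero? v

  NonZeroPair-Orbit : ∀ p p' → Orbit p p' → NonZeroPair p → NonZeroPair p'
  NonZeroPair-Orbit _ _ (g , e , e') (u≢0 , v≢0) =
    NonZero-~ e (act-NonZero g u≢0) , NonZero-~ e' (act-NonZero g v≢0)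

  e₁≢0 : NonZero e₁
  e₁≢0 (1≡0 , _) = 1≢0 1≡0

  det₂-e₁ : ∀ x y → det₂ e₁ (x , y) ≡ y
  det₂-e₁ x y = solve 2 (λ x y → :1 :* y :- :0 :* x := y) refl x y

  Dependent Independent : Pair → Set
  Dependent p = NonZeroPair p × det₂ (proj₁ p) (proj₂ p) ≡ 0#
  Independent p = NonZeroPair p × det₂ (proj₁ p) (proj₂ p) ≢ 0#

  orbit-det₂≡0 : ∀ {u v u' v'} → SameOrbit u v u' v' → det₂ u v ≡ 0# → det₂ u' v' ≡ 0#
  orbit-det₂≡0 o eq = let (n , eq') = orbit-det₂ o in
    trans eq' (trans (cong (i ^ n *_) eq) (zeroʳ _))

  -- If g multiplies `e₁` by a power of i, then by linearity it multiplies every multiple of `e₁` by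
  -- the same power.
  axis-ratio : ∀ w w' → Axis w → Axis w' → SameOrbit e₁ w e₁ w' → w ~ w'
  axis-ratio (c , _) w' (_ , refl) _ (g , e , e') =
    ~-trans (~-reflexive (sym ce₁)) (~-trans (~-scale c (~-sym e))
      (~-trans (~-reflexive (trans (sym (act-scale g c e₁)) (cong (act g) ce₁))) e'))
    where
    ce₁ : scale c e₁ ≡ (c , 0#)
    ce₁ = cong₂ _,_ (*-identityʳ c) (zeroʳ c)

  -- Once u is moved to `e₁`, a vanishing determinant puts v on the axis, where its ratio to `e₁` is
  -- the invariant.
  count-dependent : ∀ {N} → Count _~_ Axis N → Count Orbit Dependent N
  count-dependent = count-map Orbit-isEquivalence (e₁ ,_)
    (λ { (x , _) (w≢0 , refl) → (e₁≢0 , w≢0) , det₂-e₁ x 0# })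
    (λ _ _ e → ε , ~-reflexive (act-ε e₁) , ~-trans (~-reflexive (act-ε _)) e)
    axis-ratio preimage
    where
    preimage : ∀ p → Dependent p → ∃ λ w → Axis w × Orbit p (e₁ , w)
    preimage (u , v) ((u≢0 , v≢0) , det≡0) = let (g , gu≡e₁) = transitive u u≢0 in
      act g v , (act-NonZero g v≢0 , (begin
        proj₂ (act g v)              ≡⟨ det₂-e₁ _ _ ⟨
        det₂ e₁ (act g v)            ≡⟨ cong (λ w → det₂ w (act g v)) gu≡e₁ ⟨
        det₂ (act g u) (act g v)     ≡⟨ det₂-act g u v ⟩
        det₂ u v                     ≡⟨ det≡0 ⟩
        0#                           ∎)) ,
      g , ~-reflexive gu≡e₁ , ~-refl
      where open ≡-Reasoning

  -- Once u is moved to `e₁`, a shear clears the first coordinate of v, leaving (0, y) with y the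
  -- determinant. `swap` identifies these vectors with the axis, so that the same count N applies.
  count-independent : ∀ {N} → Count _~_ Axis N → Count Orbit Independent N
  count-independent = count-map Orbit-isEquivalence (λ w → e₁ , swap w)
    (λ { (y , _) (w≢0 , refl) → (e₁≢0 , (λ (_ , y≡0) → w≢0 (y≡0 , refl))) ,
                                  λ det≡0 → w≢0 (trans (sym (det₂-e₁ 0# y)) det≡0 , refl) })
    (λ _ _ e → ε , ~-reflexive (act-ε e₁) , ~-trans (~-reflexive (act-ε _)) (~-swap e))
    (λ { (y , _) (y' , _) (_ , refl) (_ , refl) o → let (n , eq) = orbit-det₂ o in
         n , cong₂ _,_ (trans (sym (det₂-e₁ 0# y')) (trans eq (cong (i ^ n *_) (det₂-e₁ 0# y))))
                       (sym (zeroʳ _)) })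
    preimage
    where
    ~-swap : ∀ {w w'} → w ~ w' → swap w ~ swap w'
    ~-swap (n , refl) = n , refl
    preimage : ∀ p → Independent p → ∃ λ w → Axis w × Orbit p (e₁ , swap w)
    preimage (u , v) ((u≢0 , v≢0) , det≢0) =
      (y , 0#) , ((λ (y≡0 , _) → y≢0 y≡0) , refl) ,
      -- With z the inverse of y, this shear subtracts (x z) y = x from the first coordinate.
      shear (x * z) · g ,
      act-·-~ (shear (x * z)) g (~-reflexive gu≡e₁) (~-reflexive (act-shear-e₁ (x * z))) ,
      act-·-~ (shear (x * z)) g ~-refl (~-reflexive (trans (act-shear (x * z) x y)
        (cong (_, y) x-xzy≡0)))
      where
      open ≡-Reasoning
      g = proj₁ (transitive u u≢0)
      gu≡e₁ = proj₂ (transitive u u≢0)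
      x = proj₁ (act g v)
      y = proj₂ (act g v)
      y≢0 : y ≢ 0#
      y≢0 y≡0 = det≢0 (begin
        det₂ u v                     ≡⟨ det₂-act g u v ⟨
        det₂ (act g u) (act g v)     ≡⟨ cong (λ w → det₂ w (act g v)) gu≡e₁ ⟩
        det₂ e₁ (act g v)            ≡⟨ det₂-e₁ x y ⟩
        y                            ≡⟨ y≡0 ⟩
        0#                           ∎)
      z = proj₁ (inverse y y≢0)
      x-xzy≡0 : x - ((x * z) * y) ≡ 0#
      x-xzy≡0 = begin
        x - ((x * z) * y)     ≡⟨ solve 3 (λ x y z → x :- (x :* z) :* y := x :- x :* (y :* z)) refl x y z ⟩
        x - (x * (y * z))     ≡⟨ cong (λ s → x - (x * s)) (proj₂ (inverse y y≢0)) ⟩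
        x - (x * 1#)          ≡⟨ solve 1 (λ x → x :- x :* :1 := :0) refl x ⟩
        0#                    ∎

  -- For N = (q - 1)/4 the total is (q - 1)/2; discounting the diagonal leaves (q - 3)/2.
  count-pairs : ∀ {N} → Count _~_ Axis N → Count Orbit NonZeroPair (N ℕ.+ N)
  count-pairs c = count-map Orbit-isEquivalence (λ p → p)
    (λ { _ (inj₁ (p≢0 , _)) → p≢0 ; _ (inj₂ (p≢0 , _)) → p≢0 }) (λ _ _ o → o) (λ _ _ _ _ o → o)
    (λ p p≢0 → p , split p p≢0 , Orbit-refl)
    (count-⊎ Orbit-isEquivalence
      (λ _ _ (_ , det≡0) (_ , det≢0) o → det≢0 (orbit-det₂≡0 o det≡0))
      (count-dependent c) (count-independent c))
    where
    split : ∀ p → NonZeroPair p → Dependent p ⊎ Independent p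
    split (u , v) p≢0 with det₂ u v ≟ 0#
    ... | yes eq = inj₁ (p≢0 , eq)
    ... | no neq = inj₂ (p≢0 , neq)

  -- Blocks through one point and through two points.

  module Design (5≢0 : 1# + (1# + (1# + (1# + (1# + 0#)))) ≢ 0#) where

    1-i^4≢1 : 1-i ^ 4 ≢ 1#
    1-i^4≢1 eq = 5≢0 (begin
      1# + (1# + (1# + (1# + (1# + 0#))))
        ≡⟨ solve 0 (:1 :+ (:1 :+ (:1 :+ (:1 :+ (:1 :+ :0)))) :=
             :1 :- (:1 :- :i) :* ((:1 :- :i) :* ((:1 :- :i) :* ((:1 :- :i) :* :1)))) refl ⟩
      1# - (1-i ^ 4)    ≡⟨ cong (λ z → 1# - z) eq ⟩
      1# - 1#           ≡⟨ -‿inverseʳ 1# ⟩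
      0#                ∎)
      where open ≡-Reasoning

    1-i≢i^n : ∀ n → 1-i ≢ i ^ n * 1#
    1-i≢i^n n eq = 1-i^4≢1 (trans (cong (_^ 4) (trans eq (*-identityʳ _))) (i^n^4≡1 n))

    1≢i^n*[1-i] : ∀ n → 1# ≢ i ^ n * 1-i
    1≢i^n*[1-i] n eq = 1-i^4≢1 (begin
      1-i ^ 4                    ≡⟨ *-identityˡ _ ⟨
      1# * 1-i ^ 4               ≡⟨ cong (_* 1-i ^ 4) (i^n^4≡1 n) ⟨
      (i ^ n) ^ 4 * 1-i ^ 4      ≡⟨ solve 2 (λ x y → (x :* (x :* (x :* (x :* :1)))) :* (y :* (y :* (y :* (y :* :1))))
                                      := (x :* y) :* ((x :* y) :* ((x :* y) :* ((x :* y) :* :1))))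
                                      refl (i ^ n) 1-i ⟩
      (i ^ n * 1-i) ^ 4          ≡⟨ cong (_^ 4) eq ⟨
      1# ^ 4                     ≡⟨ 1^ 4 ⟩
      1#                         ∎)
      where open ≡-Reasoning

    ~-shear : ∀ s {w w'} j → w ≡ T j → w' ~ act (shear s) (T j) →
              ∃ λ n → proj₁ w - (s * proj₂ w) ≡ i ^ n * proj₁ w' × proj₂ w ≡ i ^ n * proj₂ w'
    ~-shear s {x , y} j refl (n , eq) = let eq' = trans (sym (act-shear s x y)) eq in
      n , cong proj₁ eq' , cong proj₂ eq'

    -- Shears keep second coordinates, and 0, 1 and 1 - i stay distinct up to powers of i, so the
    -- second coordinate alone excludes the other vertices. It also forces i^n = 1, which makes the
    -- condition on the first coordinate an exact equation for s.
    only-antipode : ∀ s a j → (a , 1-i) ~ act (shear s) (T j) → j ≡ 5F × a ≡ 1# - (s * 1-i)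
    only-antipode s a j e with position j
    ... | pole = let (n , _ , eq) = ~-shear s 0F refl e in
      ⊥-elim (1-i≢0 (x*y≡0⇒y≡0 (^≢0 n i≢0) (sym eq)))
    ... | equator k = let (n , _ , eq) = ~-shear s (middle k) (sym (T-middle k)) e in
      ⊥-elim (1≢i^n*[1-i] n eq)
    ... | antipode = let (n , eq , eq') = ~-shear s 5F refl e
                         1≡i^n = *-cancelʳ 1-i≢0 (trans (*-identityˡ 1-i) eq') in
      refl , sym (trans eq (trans (cong (_* a) (sym 1≡i^n)) (*-identityˡ a)))

    only-equator : ∀ s a j → (a , 1#) ~ act (shear s) (T j) → ∃ λ k → j ≡ middle k × τ k ≡ a + s
    only-equator s a j e with position j
    ... | pole = let (n , _ , eq) = ~-shear s 0F refl e in
      ⊥-elim (1≢0 (x*y≡0⇒y≡0 (^≢0 n i≢0) (sym eq)))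
    ... | antipode = let (n , _ , eq) = ~-shear s 5F refl e in ⊥-elim (1-i≢i^n n eq)
    ... | equator k = let (n , eq , eq') = ~-shear s (middle k) (sym (T-middle k)) e in
      k , refl , (begin
        τ k                       ≡⟨ solve 2 (λ x s → x := (x :- s :* :1) :+ s) refl (τ k) s ⟩
        (τ k - (s * 1#)) + s      ≡⟨ cong (_+ s) eq ⟩
        i ^ n * a + s             ≡⟨ cong (λ c → c * a + s) (trans (sym (*-identityʳ _)) (sym eq')) ⟩
        1# * a + s                ≡⟨ cong (_+ s) (*-identityˡ a) ⟩
        a + s                     ∎)
      where open ≡-Reasoning

    only-pole : ∀ s a j → (a , 0#) ~ act (shear s) (T j) → j ≡ 0F
    only-pole s a j e with position j
    ... | pole = refl
    ... | equator k = let (n , _ , eq) = ~-shear s (middle k) (sym (T-middle k)) e in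
      ⊥-elim (1≢0 (trans eq (zeroʳ _)))
    ... | antipode = let (n , _ , eq) = ~-shear s 5F refl e in
      ⊥-elim (1-i≢0 (trans eq (zeroʳ _)))

    act-shear-0 : ∀ u → act (shear 0#) u ≡ u
    act-shear-0 (x , y) = trans (act-shear 0# x y)
      (cong (_, y) (solve 2 (λ x y → x :- :0 :* y := x) refl x y))

    -- Since `shear 0#` acts trivially, the three lemmas on sheared vertices also compare the
    -- vertices of T with each other.
    T-injective : ∀ j j' → T j ~ T j' → j ≡ j'
    T-injective j j' e = match (position j) (~-trans e (~-reflexive (sym (act-shear-0 (T j')))))
      where
      match : ∀ {j} → Position j → T j ~ act (shear 0#) (T j') → j ≡ j'
      match pole e = sym (only-pole 0# 1# j' e)
      match antipode e = sym (proj₁ (only-antipode 0# 1# j' e))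
      match (equator k) e =
        let (k' , j'≡ , τ≡) = only-equator 0# (τ k) j' (subst (_~ _) (T-middle k) e) in
        sym (trans j'≡ (cong middle (τ-injective k' k (trans τ≡ (+-identityʳ (τ k))))))

    T≢0 : ∀ j → NonZero (T j)
    T≢0 j with position j
    ... | pole = 1≢0 ∘ proj₁
    ... | antipode = 1≢0 ∘ proj₁
    ... | equator k = subst NonZero (sym (T-middle k)) (1≢0 ∘ proj₂)

    count-block : ∀ g → Count _~_ (λ u → NonZero u × u ∈B g) 6
    count-block g = count-by {R = _~_} (↔-id _) (λ j → act g (T j))
      (λ j → act-NonZero g (T≢0 j) , j , ~-refl)
      (λ j j' e → T-injective j j' (act-~⁻ g e)) (λ _ (_ , e) → e)

    -- The antipode moves to (1 - s (1 - i), 1 - i), the only point of the block with this second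
    -- coordinate up to powers of i, so s can be recovered from the block.
    shear-injective : ∀ s t → shear s ≈B shear t → s ≡ t
    shear-injective s t (to , _) = *-cancelʳ 1-i≢0 (begin
      s * 1-i                    ≡⟨ solve 2 (λ s x → s :* x := :1 :- (:1 :- s :* x)) refl s 1-i ⟩
      1# - (1# - (s * 1-i))      ≡⟨ cong (λ z → 1# - z) (proj₂ (only-antipode t _ (proj₁ (to 5F))
                                      (subst (_~ act (shear t) (T (proj₁ (to 5F)))) (act-shear s 1# 1-i) (proj₂ (to 5F))))) ⟩
      1# - (1# - (t * 1-i))      ≡⟨ solve 2 (λ t x → t :* x := :1 :- (:1 :- t :* x)) refl t 1-i ⟨
      t * 1-i                    ∎)
      where open ≡-Reasoning

    e₁∈shear : ∀ t → e₁ ∈B shear t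
    e₁∈shear t = 0F , ~-reflexive (sym (act-shear-e₁ t))

    count-blocks-e₁ : Count _≈B_ (e₁ ∈B_) order
    count-blocks-e₁ = count-map ≈B-isEquivalence shear (λ t _ → e₁∈shear t)
      (λ { t _ refl → ≈B-refl {shear t} }) (λ s t _ _ e → shear-injective s t e)
      (λ g e₁∈g → let (t , e) = e₁∈B⇒shear g e₁∈g in t , tt , e) count-elements

    -- Only a neighbour (`τ k`, 1) can land on `e₂`, and it does so exactly for t = `τ k`; the four
    -- values give λ_1 = 4.
    count-blocks-e₁e₂ : Count _≈B_ (λ g → e₁ ∈B g × e₂ ∈B g) 4
    count-blocks-e₁e₂ = count-by {R = _≈B_} (↔-id _) (shear ∘ τ)
      (λ k → e₁∈shear (τ k) , middle k , ~-reflexive (sym (e₂-image k)))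
      (λ j k e → τ-injective j k (shear-injective (τ j) (τ k) e)) cover
      where
      e₂-image : ∀ k → act (shear (τ k)) (T (middle k)) ≡ e₂
      e₂-image k = trans (cong (act (shear (τ k))) (T-middle k)) (trans (act-shear (τ k) (τ k) 1#)
        (cong (_, 1#) (solve 1 (λ x → x :- x :* :1 := :0) refl (τ k))))
      cover : ∀ g → e₁ ∈B g × e₂ ∈B g → ∃ λ k → g ≈B shear (τ k)
      cover g (e₁∈g , e₂∈g) =
        let (t , g≈) = e₁∈B⇒shear g e₁∈g
            (j , e) = ∈B-≈B g (shear t) g≈ e₂∈g
            (k , _ , τk≡) = only-equator t 0# j e
        in k , subst (λ t → g ≈B shear t) (sym (trans τk≡ (+-identityˡ t))) g≈

    -- Only the antipodal vertex can land on `T 5F`, and then t (1 - i) = 0 leaves t = 0; hence λ_2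
    -- = 1.
    count-blocks-antipodal : Count _≈B_ (λ g → e₁ ∈B g × T 5F ∈B g) 1
    count-blocks-antipodal = shear 0# ∷ [] ,
      (λ { 0F → e₁∈shear 0# , 5F , ~-reflexive (sym (act-shear-0 (T 5F))) }) ,
      (λ { 0F 0F _ → refl }) , λ g (e₁∈g , a∈g) →
        let (t , g≈) = e₁∈B⇒shear g e₁∈g
            (j , e) = ∈B-≈B g (shear t) g≈ a∈g
        in 0F , subst (λ t → g ≈B shear t) (t≡0 t (proj₂ (only-antipode t 1# j e))) g≈
      where
      t≡0 : ∀ t → 1# ≡ 1# - (t * 1-i) → t ≡ 0#
      t≡0 t eq = *-cancelʳ 1-i≢0 (begin
        t * 1-i                   ≡⟨ solve 2 (λ t x → t :* x := :1 :- (:1 :- t :* x)) refl t 1-i ⟩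
        1# - (1# - (t * 1-i))     ≡⟨ cong (λ z → 1# - z) eq ⟨
        1# - 1#                   ≡⟨ -‿inverseʳ 1# ⟩
        0#                        ≡⟨ zeroˡ 1-i ⟨
        0# * 1-i                  ∎)
        where open ≡-Reasoning

    count-blocks : ∃ λ b → Count _≈B_ (λ _ → ⊤) b
    count-blocks = count-exists ≈B-isEquivalence _≈B?_ (λ _ → yes tt) (λ _ _ _ _ → tt)
      transformations (λ g _ → Any.map
        (λ {h} same → ≈B-pointwise g h (λ u → sym (same u))) (transformations-complete g))

    -- Left translation by k permutes the blocks; it carries the counts made at `e₁` to other points
    -- and pairs.
    count-translate : ∀ k {P Q : SL → Set} {n} → (∀ g → P g → Q (k · g)) →
                      (∀ g → Q g → P (inv k · g)) → Count _≈B_ P n → Count _≈B_ Q n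
    count-translate k fP preimage = count-map {S = _≈B_} {R = _≈B_} ≈B-isEquivalence (k ·_) fP
      (≈B-translate k) (λ g h _ _ → ≈B-translate⁻ k g h)
      (λ g q → (inv k · g) , preimage g q , ·-cancel-inv k g)

    ∈B-shift : ∀ k {u v} g → act k u ~ v → u ∈B g → v ∈B (k · g)
    ∈B-shift k g e u∈g = ∈B-~ (k · g) e (∈B-translate k g u∈g)

    count-blocks-through-image : ∀ k {u v n} → act k u ~ v →
                                 Count _≈B_ (u ∈B_) n → Count _≈B_ (v ∈B_) n
    count-blocks-through-image k e = count-translate k
      (λ g p → ∈B-shift k g e p) (λ g p → ∈B-shift (inv k) g (act-inv-~ k e) p)

    count-blocks-through : ∀ u → NonZero u → Count _≈B_ (u ∈B_) order
    count-blocks-through u u≢0 = let (k , ku≡e₁) = transitive u u≢0 in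
      count-blocks-through-image (inv k) (act-inv-~ k (~-reflexive ku≡e₁)) count-blocks-e₁

    count-blocks-through₂ : ∀ {u v u' v' n} → SameOrbit u v u' v' →
      Count _≈B_ (λ g → u ∈B g × v ∈B g) n → Count _≈B_ (λ g → u' ∈B g × v' ∈B g) n
    count-blocks-through₂ (k , e , e') = count-translate k
      (λ g (p , q) → ∈B-shift k g e p , ∈B-shift k g e' q)
      (λ g (p , q) → ∈B-shift (inv k) g (act-inv-~ k e) p , ∈B-shift (inv k) g (act-inv-~ k e') q)

    -- An equal, an adjacent and an antipodal pair. Their orbits become the classes 0, 1 and 2, as
    -- the clauses of `lambdas` require.
    x₀ x₁ x₂ : Pair
    x₀ = e₁ , e₁
    x₁ = e₁ , e₂
    x₂ = e₁ , T 5F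

    -- Pulling the block back to T with u at `e₁` makes v a vertex of T, and the shears, which fix
    -- `e₁`, take the four equatorial cases to `e₂`. Hence λ_j = 0 outside these three orbits.
    ∈B⇒orbit : ∀ {u v} g → u ∈B g → v ∈B g →
               Orbit (u , v) x₀ ⊎ Orbit (u , v) x₁ ⊎ Orbit (u , v) x₂
    ∈B⇒orbit {u} {v} g u∈g v∈g =
      let (h , h≈g , he₁~u) = ∈B⇒vertex g u∈g
          (j , v~hTj) = ∈B-≈B g h (≈B-sym {h} {g} h≈g) v∈g
      in classify (position j) (Orbit-sym (h , he₁~u , ~-sym v~hTj))
      where
      classify : ∀ {j} → Position j → Orbit (u , v) (e₁ , T j) →
                 Orbit (u , v) x₀ ⊎ Orbit (u , v) x₁ ⊎ Orbit (u , v) x₂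
      classify pole o = inj₁ o
      classify antipode o = inj₂ (inj₂ o)
      classify (equator k) o = inj₂ (inj₁ (Orbit-trans o
        (shear (τ k) , ~-reflexive (act-shear-e₁ (τ k)) , ~-reflexive
          (trans (cong (act (shear (τ k))) (T-middle k)) (trans (act-shear (τ k) (τ k) 1#)
            (cong (_, 1#) (solve 1 (λ x → x :- x :* :1 := :0) refl (τ k))))))))

    ¬Orbit-x₁-x₀ : ¬ Orbit x₁ x₀
    ¬Orbit-x₁-x₀ o = 1≢0 (trans (sym (det₂-e₁ 0# 1#))
      (orbit-det₂≡0 (Orbit-sym o) (det₂-e₁ 1# 0#)))

    ¬Orbit-x₂-x₀ : ¬ Orbit x₂ x₀
    ¬Orbit-x₂-x₀ o = 1-i≢0 (trans (sym (det₂-e₁ 1# 1-i))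
      (orbit-det₂≡0 (Orbit-sym o) (det₂-e₁ 1# 0#)))

    ¬Orbit-x₂-x₁ : ¬ Orbit x₂ x₁
    ¬Orbit-x₂-x₁ o = let (n , eq) = orbit-det₂ o in
      1≢i^n*[1-i] n (trans (sym (det₂-e₁ 0# 1#)) (trans eq (cong (i ^ n *_) (det₂-e₁ 1# 1-i))))

    -- One orbit is discarded at a time, so that `count-cons-orbit` can put `x₂`, `x₁` and `x₀` back
    -- in this order and they end up in front.
    Excluding₁ Excluding₂ Excluding₃ : Pair → Set
    Excluding₁ p = NonZeroPair p × ¬ Orbit p x₀
    Excluding₂ p = Excluding₁ p × ¬ Orbit p x₁
    Excluding₃ p = Excluding₂ p × ¬ Orbit p x₂

    abstract
      count-remaining : ∃ (Count Orbit Excluding₃)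
      count-remaining = count-exists Orbit-isEquivalence Orbit?
        (λ p → ((NonZeroPair? p ×-dec ¬? (Orbit? p x₀)) ×-dec ¬? (Orbit? p x₁)) ×-dec ¬? (Orbit? p x₂))
        (λ p p' o (((≢0 , ¬0) , ¬1) , ¬2) →
          ((NonZeroPair-Orbit p p' o ≢0 , ¬0 ∘ Orbit-trans o) , ¬1 ∘ Orbit-trans o) ,
          ¬2 ∘ Orbit-trans o)
        (cartesianProduct vectors vectors)
        (λ (u , v) _ → Any.map (λ { refl → Orbit-refl })
          (∈-cartesianProduct⁺ (vectors-complete u) (vectors-complete v)))

    remaining : ℕ
    remaining = proj₁ count-remaining

    count-cons-orbit : ∀ (Q : Pair → Set) {n} x → Q x →
                       Count Orbit (λ p → Q p × ¬ Orbit p x) n → Count Orbit Q (suc n)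
    count-cons-orbit Q x q = count-cons Orbit-isEquivalence x q (λ _ p → p) split
      where
      split : ∀ p → Q p → Orbit p x ⊎ (Q p × ¬ Orbit p x)
      split p q with Orbit? p x
      ... | yes o = inj₁ o
      ... | no ¬o = inj₂ (q , ¬o)

    count-classes₂ : Count Orbit Excluding₂ (suc remaining)
    count-classes₂ = count-cons-orbit Excluding₂ x₂
      (((e₁≢0 , T≢0 5F) , ¬Orbit-x₂-x₀) , ¬Orbit-x₂-x₁) (proj₂ count-remaining)

    count-classes₁ : Count Orbit Excluding₁ (2 ℕ.+ remaining)
    count-classes₁ = count-cons-orbit Excluding₁ x₁
      ((e₁≢0 , λ (_ , 1≡0) → 1≢0 1≡0) , ¬Orbit-x₁-x₀) count-classes₂

    classes : Count Orbit NonZeroPair (3 ℕ.+ remaining)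
    classes = count-cons-orbit NonZeroPair x₀ (e₁≢0 , e₁≢0) count-classes₁

    -- The association scheme of orbits.

    module Classes (k : ℕ) (others : Vec Pair k)
      (rep-NonZero : ∀ c → NonZeroPair (lookup (x₀ ∷ x₁ ∷ x₂ ∷ others) c))
      (rep-injective : ∀ c c' → Orbit (lookup (x₀ ∷ x₁ ∷ x₂ ∷ others) c)
                                      (lookup (x₀ ∷ x₁ ∷ x₂ ∷ others) c') → c ≡ c')
      (rep-complete : ∀ p → NonZeroPair p → ∃ λ c → Orbit p (lookup (x₀ ∷ x₁ ∷ x₂ ∷ others) c))
      where

      rep : Fin (3 ℕ.+ k) → Pair
      rep = lookup (x₀ ∷ x₁ ∷ x₂ ∷ others)

      -- The value on pairs with a zero vector is immaterial.
      cls : V → V → Fin (3 ℕ.+ k)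
      cls u v with NonZeroPair? (u , v)
      ... | yes p = proj₁ (rep-complete (u , v) p)
      ... | no _ = zero

      orbit-cls : ∀ u v → NonZero u → NonZero v → Orbit (u , v) (rep (cls u v))
      orbit-cls u v u≢0 v≢0 with NonZeroPair? (u , v)
      ... | yes p = proj₂ (rep-complete (u , v) p)
      ... | no ¬p = ⊥-elim (¬p (u≢0 , v≢0))

      orbit⇒cls : ∀ u v → NonZero u → NonZero v → ∀ c → Orbit (u , v) (rep c) → cls u v ≡ c
      orbit⇒cls u v u≢0 v≢0 c o =
        rep-injective _ _ (Orbit-trans (Orbit-sym (orbit-cls u v u≢0 v≢0)) o)

      cls⇒orbit : ∀ u v → NonZero u → NonZero v → ∀ c → cls u v ≡ c → Orbit (u , v) (rep c)
      cls⇒orbit u v u≢0 v≢0 _ refl = orbit-cls u v u≢0 v≢0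

      orbit⇒cls≡cls : ∀ u v u' v' → NonZero u → NonZero v → NonZero u' → NonZero v' →
                      SameOrbit u v u' v' → cls u v ≡ cls u' v'
      orbit⇒cls≡cls u v u' v' u≢0 v≢0 u'≢0 v'≢0 o =
        orbit⇒cls u v u≢0 v≢0 _ (Orbit-trans o (orbit-cls u' v' u'≢0 v'≢0))

      schurian : IsSchurianPartition cls
      schurian =
        (λ u v u' v' u≢0 v≢0 u'≢0 v'≢0 →
          (λ eq → Orbit-trans (cls⇒orbit u v u≢0 v≢0 _ eq)
                    (Orbit-sym (orbit-cls u' v' u'≢0 v'≢0))) ,
          orbit⇒cls≡cls u v u' v' u≢0 v≢0 u'≢0 v'≢0) ,
        λ c → let (u≢0 , v≢0) = rep-NonZero c in
          proj₁ (rep c) , proj₂ (rep c) , u≢0 , v≢0 , orbit⇒cls _ _ u≢0 v≢0 c Orbit-refl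

      -- Transitivity on points makes the diagonal a single orbit, and cancelling g shows that
      -- nothing else lies in it.
      diagonal : ∀ u v → NonZero u → NonZero v → (cls u v ≡ zero → u ~ v) × (u ~ v → cls u v ≡ zero)
      diagonal u v u≢0 v≢0 =
        (λ eq → let (g , e , e') = cls⇒orbit u v u≢0 v≢0 zero eq in act-~⁻ g (~-trans e (~-sym e'))) ,
        (λ e → let (g , gu≡e₁) = transitive u u≢0 ; gu~e₁ = ~-reflexive gu≡e₁ in
          orbit⇒cls u v u≢0 v≢0 zero (g , gu~e₁ , ~-trans (act-~ g (~-sym e)) gu~e₁))

      converse : ∀ c → ∃ λ c' → ∀ u v → NonZero u → NonZero v →
                 (cls u v ≡ c → cls v u ≡ c') × (cls v u ≡ c' → cls u v ≡ c)
      converse c = let (a≢0 , b≢0) = rep-NonZero c in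
        cls b a , λ u v u≢0 v≢0 →
          (λ eq → let (g , e , e') = cls⇒orbit u v u≢0 v≢0 c eq in
            orbit⇒cls≡cls v u b a v≢0 u≢0 b≢0 a≢0 (g , e' , e)) ,
          (λ eq → let (g , e , e') = Orbit-trans (cls⇒orbit v u v≢0 u≢0 _ eq)
                                       (Orbit-sym (orbit-cls b a b≢0 a≢0)) in
            orbit⇒cls u v u≢0 v≢0 c (g , e' , e))
        where
        a = proj₁ (rep c)
        b = proj₂ (rep c)

      Between : V → V → (a b : Fin (3 ℕ.+ k)) → V → Set
      Between u w a b v = NonZero v × cls u v ≡ a × cls v w ≡ b

      Between-act : ∀ {u w u' w' a b} → NonZeroPair (u , w) → NonZeroPair (u' , w') →
                    ∀ g → act g u ~ u' → act g w ~ w' →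
                    ∀ v v' → act g v ~ v' → Between u w a b v → Between u' w' a b v'
      Between-act (u≢0 , w≢0) (u'≢0 , w'≢0) g e e' v v' e'' (v≢0 , eq , eq') =
        v'≢0 ,
        trans (sym (orbit⇒cls≡cls _ _ _ _ u≢0 v≢0 u'≢0 v'≢0 (g , e , e''))) eq ,
        trans (sym (orbit⇒cls≡cls _ _ _ _ v≢0 w≢0 v'≢0 w'≢0 (g , e'' , e'))) eq'
        where v'≢0 = NonZero-~ e'' (act-NonZero g v≢0)

      -- A group element carrying (u, w) to (u', w') maps the intermediate points of one pair
      -- bijectively to those of the other, so that one count per class, at its representative,
      -- determines an intersection number.
      count-between-act : ∀ {u w u' w' a b p} → NonZeroPair (u , w) → NonZeroPair (u' , w') →
                          SameOrbit u w u' w' →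
                          Count _~_ (Between u w a b) p → Count _~_ (Between u' w' a b) p
      count-between-act {u} {w} {u'} {w'} {a} {b} ≢0 ≢0' (g , e , e') =
        count-map {S = _~_} {P = Between u w a b} {Q = Between u' w' a b} {R = _~_}
          ~-isEquivalence (act g)
          (λ v → Between-act ≢0 ≢0' g e e' v (act g v) ~-refl)
          (λ _ _ → act-~ g) (λ _ _ _ _ → act-~⁻ g)
          (λ v v∈ → act (inv g) v ,
            Between-act ≢0' ≢0 (inv g) (act-inv-~ g e) (act-inv-~ g e') v (act (inv g) v) ~-refl v∈ ,
            ~-reflexive (sym (act-inv′ g v)))

      count-between : ∀ u w a b → NonZeroPair (u , w) → ∃ (Count _~_ (Between u w a b))
      count-between u w a b ≢0 = count-exists ~-isEquivalence _~?_
        (λ v → NonZero? v ×-dec (cls u v Finₚ.≟ a) ×-dec (cls v w Finₚ.≟ b))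
        -- Invariance of the condition under ~ is the case g = ε.
        (λ v v' e → Between-act ≢0 ≢0 ε (~-reflexive (act-ε u)) (~-reflexive (act-ε w)) v v'
          (~-trans (~-reflexive (act-ε v)) e))
        vectors (λ v _ → Any.map ~-reflexive (vectors-complete v))

      intersection : ∀ a b c → ∃ λ p → ∀ u w → NonZero u → NonZero w → cls u w ≡ c →
                     Count _~_ (Between u w a b) p
      intersection a b c = let (p , count) = count-between _ _ a b (rep-NonZero c) in
        p , λ u w u≢0 w≢0 eq → count-between-act (rep-NonZero c) (u≢0 , w≢0)
              (Orbit-sym (cls⇒orbit u w u≢0 w≢0 c eq)) count

      concurrence : ∀ j → ¬ (j ≡ zero) → ∀ u v → NonZero u → NonZero v → cls u v ≡ j →
                    Count _≈B_ (λ g → (u ∈B g) × (v ∈B g)) (lambdas j)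
      concurrence zero j≢0 = ⊥-elim (j≢0 refl)
      concurrence (suc zero) _ u v u≢0 v≢0 eq =
        count-blocks-through₂ {e₁} {e₂} (Orbit-sym (cls⇒orbit u v u≢0 v≢0 _ eq)) count-blocks-e₁e₂
      concurrence (suc (suc zero)) _ u v u≢0 v≢0 eq =
        count-blocks-through₂ {e₁} {T 5F} (Orbit-sym (cls⇒orbit u v u≢0 v≢0 _ eq))
          count-blocks-antipodal
      concurrence (suc (suc (suc j))) _ u v u≢0 v≢0 eq =
        -- A common block would put the pair into class 0, 1 or 2.
        [] , (λ ()) , (λ ()) , λ g (u∈g , v∈g) → ⊥-elim (none (∈B⇒orbit g u∈g v∈g))
        where
        same-class : ∀ c → Orbit (u , v) (rep c) → c ≡ suc (suc (suc j))
        same-class c o = trans (sym (orbit⇒cls u v u≢0 v≢0 c o)) eq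
        none : ¬ (Orbit (u , v) x₀ ⊎ Orbit (u , v) x₁ ⊎ Orbit (u , v) x₂)
        none (inj₁ o) = case same-class zero o of λ ()
        none (inj₂ (inj₁ o)) = case same-class (suc zero) o of λ ()
        none (inj₂ (inj₂ o)) = case same-class (suc (suc zero)) o of λ ()

    -- The parameters v, b and m.

    number-of-points : Count _~_ NonZero ((order ℕ.* order ℕ.∸ 1) ℕ./ 4)
    number-of-points = let (v , q²≡ , c) = count-points in
      subst (Count _~_ NonZero)
        (sym (trans (cong (λ s → (s ℕ.∸ 1) ℕ./ 4) q²≡) (ℕᵈ.m*n/n≡m v 4))) c

    -- Flags are counted once by points and once by blocks.
    number-of-blocks : Count _≈B_ (λ _ → ⊤) ((order ℕ.* (order ℕ.* order ℕ.∸ 1)) ℕ./ 24)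
    number-of-blocks = subst (Count _≈B_ (λ _ → ⊤)) (sym (begin
      (q ℕ.* (q ℕ.* q ℕ.∸ 1)) ℕ./ 24    ≡⟨ cong (λ s → (q ℕ.* (s ℕ.∸ 1)) ℕ./ 24) q²≡ ⟩
      (q ℕ.* (v ℕ.* 4)) ℕ./ 24          ≡⟨ cong (ℕ._/ 24) (ℕₚ.*-assoc q v 4) ⟨
      ((q ℕ.* v) ℕ.* 4) ℕ./ 24          ≡⟨ cong (λ s → (s ℕ.* 4) ℕ./ 24) (trans (ℕₚ.*-comm q v) flags) ⟩
      ((b ℕ.* 6) ℕ.* 4) ℕ./ 24          ≡⟨ cong (ℕ._/ 24) (ℕₚ.*-assoc b 6 4) ⟩
      (b ℕ.* 24) ℕ./ 24                 ≡⟨ ℕᵈ.m*n/n≡m b 24 ⟩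
      b                                 ∎)) (proj₂ count-blocks)
      where
      open ≡-Reasoning
      q = order
      v = proj₁ count-points
      q²≡ = proj₁ (proj₂ count-points)
      b = proj₁ count-blocks
      flags : v ℕ.* q ≡ b ℕ.* 6
      flags = double-count {I = λ u g → NonZero u × u ∈B g} ~-isEquivalence ≈B-isEquivalence
        (λ _ _ (u≢0 , _) → u≢0 , tt)
        (λ u u' g e (u≢0 , u∈g) → NonZero-~ e u≢0 , ∈B-~ g e u∈g)
        (λ u g h e (u≢0 , u∈g) → u≢0 , ∈B-≈B g h e u∈g)
        (proj₂ (proj₂ count-points))
        (λ u u≢0 → count-map ≈B-isEquivalence (λ g → g) (λ _ u∈g → u≢0 , u∈g)
          (λ _ _ e → e) (λ _ _ _ _ e → e) (λ g (_ , u∈g) → g , u∈g , ≈B-refl {g})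
          (count-blocks-through u u≢0))
        (proj₂ count-blocks) (λ g _ → count-block g)

    number-of-classes : 2 ℕ.+ remaining ≡ (order ℕ.∸ 3) ℕ./ 2
    number-of-classes = sym (begin
      (order ℕ.∸ 3) ℕ./ 2                    ≡⟨ cong (λ s → (s ℕ.∸ 3) ℕ./ 2) q≡ ⟩
      (N ℕ.* 4 ℕ.∸ 2) ℕ./ 2                  ≡⟨ cong (λ s → (s ℕ.∸ 2) ℕ./ 2) (ℕₚ.*-assoc N 2 2) ⟨
      -- `size` equates two counts of the orbits of pairs; subtracting 2 from twice 3 + `remaining`
      -- then computes to twice 2 + `remaining`, which discounts the diagonal.
      (N ℕ.* 2 ℕ.* 2 ℕ.∸ 2) ℕ./ 2            ≡⟨ cong (λ s → (s ℕ.* 2 ℕ.∸ 2) ℕ./ 2) (trans N*2≡ (sym size)) ⟩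
      ((2 ℕ.+ remaining) ℕ.* 2) ℕ./ 2                ≡⟨ ℕᵈ.m*n/n≡m (2 ℕ.+ remaining) 2 ⟩
      2 ℕ.+ remaining                                ∎)
      where
      open ≡-Reasoning
      N = proj₁ count-axis
      q≡ = proj₁ (proj₂ count-axis)
      size : 3 ℕ.+ remaining ≡ N ℕ.+ N
      size = count-unique Orbit-isEquivalence classes (count-pairs (proj₂ (proj₂ count-axis)))
      N*2≡ : N ℕ.* 2 ≡ N ℕ.+ N
      N*2≡ = trans (ℕₚ.*-comm N 2) (cong (N ℕ.+_) (ℕₚ.+-identityʳ N))

    -- The enumeration yields 2 + `remaining` associate classes, equal to (q - 3)/2 only by a proof,
    -- so the partition and everything claimed about it are transported together.
    scheme : Σ (V → V → Fin (suc ((order ℕ.∸ 3) ℕ./ 2))) λ cls →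
      IsSchurianPartition cls × IsAssociationScheme cls ×
      (∀ j → ¬ (j ≡ zero) → ∀ u v → NonZero u → NonZero v → cls u v ≡ j →
        Count _≈B_ (λ g → (u ∈B g) × (v ∈B g)) (lambdas j))
    scheme = subst
      (λ m → Σ (V → V → Fin (suc m)) λ cls → IsSchurianPartition cls × IsAssociationScheme cls ×
        (∀ j → ¬ (j ≡ zero) → ∀ u v → NonZero u → NonZero v → cls u v ≡ j →
          Count _≈B_ (λ g → (u ∈B g) × (v ∈B g)) (lambdas j)))
      number-of-classes
      (cls , schurian , (diagonal , converse , intersection) , concurrence)
      where
      reps = proj₂ classes
      open Classes remaining (proj₁ (proj₂ count-remaining)) (proj₁ reps) (proj₁ (proj₂ reps)) (proj₂ (proj₂ reps))

open import Data.Nat using (_*_; _∸_; _/_; _%_; _^_)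

theorem2p8 :
  (F : FiniteField) →
  let q = FiniteField.order F in
  (p α : ℕ) → Prime p → q ≡ p ^ α → ¬ (p ≡ 5) → q % 4 ≡ 1 →
  (ω : FiniteField.Carrier F) → Geometry.IsGenerator F ω →
  let open Geometry F
      open WithGenerator ω
      m = (q ∸ 3) / 2
  in
  -- v = (q^2 - 1)/4 points
  Count _~_ NonZero ((q * q ∸ 1) / 4) ×
  -- b = q(q^2 - 1)/24 blocks
  Count _≈B_ (λ _ → ⊤) ((q * (q * q ∸ 1)) / 24) ×
  -- every block has k = 6 points
  (∀ g → Count _~_ (λ u → NonZero u × u ∈B g) 6) ×
  -- every point lies on r = q blocks
  (∀ u → NonZero u → Count _≈B_ (λ g → u ∈B g) q) ×
  -- the Schurian scheme S(G,P) is an association scheme with m classes,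
  -- and pairs in class j lie together in exactly λ_j blocks
  (Σ (V → V → Fin (suc m)) λ cls →
     IsSchurianPartition cls ×
     IsAssociationScheme cls ×
     (∀ (j : Fin (suc m)) → ¬ (j ≡ zero) → ∀ u v → NonZero u → NonZero v →
        cls u v ≡ j → Count _≈B_ (λ g → (u ∈B g) × (v ∈B g)) (lambdas j)))
theorem2p8 F p α p-prime q≡pᵅ p≢5 q%4≡1 ω generates =
  number-of-points , number-of-blocks , count-block , count-blocks-through , scheme
  where
  open Octahedron F ω generates q%4≡1
  open Design (FiniteFieldProperties.5·1≢0 F α p-prime q≡pᵅ p≢5)
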